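{- Fix $r\ge1$ and $b_1$. Let $\mathbf b=(b_1,\dots,b_r)$ and $\mathbf b'=(b_1',\dots,b_r')$ be two nonincreasing integer sequences with $b_i\ge i$ and $b_i'\ge i$ for all $i$, with $b_1'=b_1$ and $b_i\le b_i'$ for every $i$. Then $$\mathbb{H}_{F_{\mathbf b},\rho}(q,t)\preceq\mathbb{H}_{F_{\mathbf b'},\rho}(q,t),$$ where $A\preceq B$ means $B-A\in\mathbb{N}[q,t]$. More generally, if $x=(i,c)\le y=(j,d)$ are cells common to both $F_{\mathbf b}$ and $F_{\mathbf b'}$, then $$\mathbb{H}_{[x,y]_{\mathbf b},\rho_{x,y}}(q,t)\preceq\mathbb{H}_{[x,y]_{\mathbf b'},\rho_{x,y}}(q,t),$$ where $[x,y]_{\mathbf b}$ and $[x,y]_{\mathbf b'}$ are the intervals in $F_{\mathbf b}$ and $F_{\mathbf b'}$ and $\rho_{x,y}(z)=\rho(z)-\rho(x)$. In particular, for fixed $r$ and $b_1\ge r$, the boundary sequences $(b_1,r,\dots,r)$ and $(b_1,\dots,b_1)$ give coefficientwise lower and upper bounds, respectively, for every boundary of length $r$ with first entry $b_1$.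
   Context: $\mathbb N=\{0,1,2,\dots\}$. $q$-Zeta numerator: let $P$ be a finite graded poset with a unique maximum and rank function $\rho:P\to\{0,\dots,H\}$, where $H$ is the maximal rank. For $m\ge 0$ put $A_m(P,\rho;q)=\sum_{x_1\le\cdots\le x_m}q^{\rho(x_1)+\cdots+\rho(x_m)}$ (sum over weak chains in $P$; $A_0=1$). The numerator $\mathbb{H}_{P,\rho}(q,t)$ is the polynomial determined by $\sum_{m\ge 0}A_m(P,\rho;q)t^m=\mathbb{H}_{P,\rho}(q,t)/\prod_{a=0}^{H}(1-q^at)$. Ferrers-cell poset: for integers $b_1\ge\cdots\ge b_r$ with $b_i\ge i$, $F_{\mathbf b}=\{(i,c):1\le i\le r,\ i\le c\le b_i\}$, ordered by $(i,c)\le(j,d)\iff i\ge j$ and $c\le d$, with rank $\rho(i,c)=c-i$. -}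

module Defs where

open import Data.Bool using (true; false; if_then_else_)
open import Data.Empty using (⊥-elim)
open import Data.Fin using (Fin; zero; suc; toℕ; inject₁)
open import Data.Fin.Properties using (toℕ-injective; toℕ-inject₁)
import Data.Fin as Fin
import Data.Fin.Properties as Finₚ
open import Data.Integer using (ℤ; +_; 0ℤ; 1ℤ; _+_; _-_; -_) renaming (_≤_ to _≤ℤ_)
import Data.Integer.Properties as ℤₚ
open import Data.Integer.Tactic.RingSolver using (solve-∀)
open import Data.List using (List; []; _∷_; length; map; filter; cartesianProduct; cartesianProductWith; allFin; upTo; _++_)
open import Data.List.Membership.Propositional using (_∈_)
open import Data.List.Membership.Propositional.Properties
  using (∈-filter⁺; ∈-filter⁻; ∈-cartesianProduct⁺; ∈-allFin; ∈-upTo⁺)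
open import Data.List.Properties using (filter-++; filter-≐; length-++)
import Data.List.Relation.Unary.All as All
open import Data.List.Relation.Unary.AllPairs using ([]; _∷_)
open import Data.List.Relation.Unary.Any using (here; there)
open import Data.List.Relation.Unary.Unique.Propositional using (Unique)
import Data.List.Relation.Unary.Unique.Propositional.Properties as Uniqueₚ
open import Data.Nat using (ℕ; zero; suc; _∸_; _⊔_; _≤_; _<_; _≤?_; _≟_; z≤n; s≤s; s<s⁻¹; s≤s⁻¹)
  renaming (_+_ to _+ℕ_)
import Data.Nat.Properties as ℕₚ
open import Data.Product using (_×_; _,_; proj₁; proj₂; ∃-syntax)
open import Data.Product.Properties using (≡-dec)
open import Data.Sum using (_⊎_; inj₁; inj₂)
open import Data.Vec using (Vec; []; _∷_)
import Data.Vec as Vec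
open import Data.Vec.Relation.Unary.Linked using (Linked; []; [-]; _∷_; linked?)
open import Function using (_∘_)
open import Level using (0ℓ)
open import Relation.Binary using (Rel; IsDecPartialOrder)
open import Relation.Binary.PropositionalEquality
open import Relation.Nullary using (Dec; yes; no; does; ¬_; ¬?)
open import Relation.Nullary.Decidable using (_×-dec_)
open import Relation.Unary using (Pred; Decidable)

infixr 7 q·_ t·_ q^_·_
infixl 6 _⊕_ _⊖_
infix 4 _≼_

-- S m k is the coefficient of tᵐ qᵏ.
Series : Set
Series = ℕ → ℕ → ℤ

q·_ t·_ : Series → Series
(q· S) m zero    = 0ℤ
(q· S) m (suc k) = S m k
(t· S) zero    k = 0ℤ
(t· S) (suc m) k = S m k

q^_·_ : ℕ → Series → Series
q^ zero  · S = S
q^ suc a · S = q· q^ a · S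

_⊕_ _⊖_ : Series → Series → Series
(S ⊕ T) m k = S m k + T m k
(S ⊖ T) m k = S m k - T m k

-- Multiplication by 1 - qᵃ t.
[1-q^_t]·_ : ℕ → Series → Series
[1-q^ a t]· S = S ⊖ q^ a · t· S

-- Multiplication by the product of the n factors 1 - qᵃ t, …, 1 - qᵃ⁺ⁿ⁻¹ t.
∏[1-q^t] : (a n : ℕ) → Series → Series
∏[1-q^t] a zero    S = S
∏[1-q^t] a (suc n) S = [1-q^ a t]· ∏[1-q^t] (suc a) n S

-- Total degree is bounded; equivalently, only finitely many nonzero coefficients.
IsPolynomial : Series → Set
IsPolynomial S = ∃[ N ] ∀ m k → N < m +ℕ k → S m k ≡ 0ℤ

record ℤ[q,t] : Set where
  constructor poly
  field
    coeff        : Series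
    isPolynomial : IsPolynomial coeff
open ℤ[q,t] public

-- B - A lies in ℕ[q,t]; its finite support is automatic.
_≼_ : ℤ[q,t] → ℤ[q,t] → Set
A ≼ B = ∀ m k → 0ℤ ≤ℤ (coeff B ⊖ coeff A) m k

-- The underlying set of the poset is the finite set listed by `elements` inside
-- the ambient partially ordered type Carrier, so that a subposet such as an
-- interval keeps the same Carrier.
record GradedPoset : Set₁ where
  infix 4 _⊑_
  field
    Carrier           : Set
    _⊑_               : Rel Carrier 0ℓ
    isDecPartialOrder : IsDecPartialOrder _≡_ _⊑_
    elements          : List Carrier
    unique            : Unique elements
    top               : Carrier
    top∈              : top ∈ elements
    ⊑-top             : ∀ {x} → x ∈ elements → x ⊑ top
    ρ                 : Carrier → ℕ
    ρ-strict          : ∀ {x y} → x ∈ elements → y ∈ elements → x ⊑ y → x ≢ y → ρ x < ρ y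
    ρ-cover           : ∀ {x y} → x ∈ elements → y ∈ elements → x ⊑ y → x ≢ y →
                        (∀ {z} → z ∈ elements → x ⊑ z → z ⊑ y → z ≡ x ⊎ z ≡ y) →
                        ρ y ≡ suc (ρ x)

  open IsDecPartialOrder isDecPartialOrder public
    using () renaming (refl to ⊑-refl; trans to ⊑-trans; antisym to ⊑-antisym; _≤?_ to _⊑?_; _≟_ to _≡?_)

  -- ρ is strictly increasing, so its largest value is attained at the maximum.
  maxRank : ℕ
  maxRank = ρ top

  tuples : (m : ℕ) → List (Vec Carrier m)
  tuples zero    = [] ∷ []
  tuples (suc m) = cartesianProductWith _∷_ elements (tuples m)

  totalRank : ∀ {m} → Vec Carrier m → ℕ
  totalRank v = Vec.sum (Vec.map ρ v)

  weakChains : (m k : ℕ) → List (Vec Carrier m)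
  weakChains m k = filter (λ v → linked? _⊑?_ v ×-dec (totalRank v ≟ k)) (tuples m)

  -- ∑ₘ Aₘ(q) tᵐ: the coefficient of qᵏ in Aₘ counts the weak chains
  -- x₁ ⊑ ⋯ ⊑ xₘ of total rank k.
  zetaSeries : Series
  zetaSeries m k = + length (weakChains m k)

  numeratorSeries : Series
  numeratorSeries = ∏[1-q^t] 0 (suc maxRank) zetaSeries

open GradedPoset using (Carrier; elements; ρ; numeratorSeries)

------------------------------------------------------------------------
-- The numerator is a polynomial.

module Polynomiality where

  infix 4 _≈_

  _≈_ : Series → Series → Set
  S ≈ T = ∀ m k → S m k ≡ T m k

  ≈-sym : ∀ {S T} → S ≈ T → T ≈ S
  ≈-sym p m k = sym (p m k)

  ≈-trans : ∀ {S T U} → S ≈ T → T ≈ U → S ≈ U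
  ≈-trans p q m k = trans (p m k) (q m k)

  𝟘 𝟙 : Series
  𝟘 _ _ = 0ℤ
  𝟙 zero    zero    = 1ℤ
  𝟙 zero    (suc k) = 0ℤ
  𝟙 (suc m) k       = 0ℤ

  ⊕-cong : ∀ {S S′ T T′} → S ≈ S′ → T ≈ T′ → S ⊕ T ≈ S′ ⊕ T′
  ⊕-cong p q m k = cong₂ _+_ (p m k) (q m k)

  ⊖-cong : ∀ {S S′ T T′} → S ≈ S′ → T ≈ T′ → S ⊖ T ≈ S′ ⊖ T′
  ⊖-cong p q m k = cong₂ _-_ (p m k) (q m k)

  q-cong : ∀ {S T} → S ≈ T → q· S ≈ q· T
  q-cong p m zero    = refl
  q-cong p m (suc k) = p m k

  t-cong : ∀ {S T} → S ≈ T → t· S ≈ t· T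
  t-cong p zero    k = refl
  t-cong p (suc m) k = p m k

  q^-cong : ∀ a {S T} → S ≈ T → q^ a · S ≈ q^ a · T
  q^-cong zero    p = p
  q^-cong (suc a) p = q-cong (q^-cong a p)

  -- Multiplication by the monomial qᵃ t.
  mono : ℕ → Series → Series
  mono a S = q^ a · t· S

  mono-cong : ∀ a {S T} → S ≈ T → mono a S ≈ mono a T
  mono-cong a p = q^-cong a (t-cong p)

  q-⊕ : ∀ S T → q· (S ⊕ T) ≈ q· S ⊕ q· T
  q-⊕ S T m zero    = refl
  q-⊕ S T m (suc k) = refl

  t-⊕ : ∀ S T → t· (S ⊕ T) ≈ t· S ⊕ t· T
  t-⊕ S T zero    k = refl
  t-⊕ S T (suc m) k = refl

  q^-⊕ : ∀ a S T → q^ a · (S ⊕ T) ≈ q^ a · S ⊕ q^ a · T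
  q^-⊕ zero    S T m k = refl
  q^-⊕ (suc a) S T = ≈-trans (q-cong (q^-⊕ a S T)) (q-⊕ _ _)

  mono-⊕ : ∀ a S T → mono a (S ⊕ T) ≈ mono a S ⊕ mono a T
  mono-⊕ a S T = ≈-trans (q^-cong a (t-⊕ S T)) (q^-⊕ a _ _)

  q-⊖ : ∀ S T → q· (S ⊖ T) ≈ q· S ⊖ q· T
  q-⊖ S T m zero    = refl
  q-⊖ S T m (suc k) = refl

  t-⊖ : ∀ S T → t· (S ⊖ T) ≈ t· S ⊖ t· T
  t-⊖ S T zero    k = refl
  t-⊖ S T (suc m) k = refl

  q^-⊖ : ∀ a S T → q^ a · (S ⊖ T) ≈ q^ a · S ⊖ q^ a · T
  q^-⊖ zero    S T m k = refl
  q^-⊖ (suc a) S T = ≈-trans (q-cong (q^-⊖ a S T)) (q-⊖ _ _)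

  mono-⊖ : ∀ a S T → mono a (S ⊖ T) ≈ mono a S ⊖ mono a T
  mono-⊖ a S T = ≈-trans (q^-cong a (t-⊖ S T)) (q^-⊖ a _ _)

  tq : ∀ S → t· q· S ≈ q· t· S
  tq S zero    zero    = refl
  tq S zero    (suc k) = refl
  tq S (suc m) zero    = refl
  tq S (suc m) (suc k) = refl

  q^q : ∀ a S → q^ a · q· S ≈ q· q^ a · S
  q^q zero    S m k = refl
  q^q (suc a) S = q-cong (q^q a S)

  mono-q : ∀ a S → mono a (q· S) ≈ q· mono a S
  mono-q a S = ≈-trans (q^-cong a (tq S)) (q^q a _)

  q^t : ∀ a S → t· q^ a · S ≈ q^ a · t· S
  q^t zero    S m k = refl
  q^t (suc a) S = ≈-trans (tq _) (q-cong (q^t a S))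

  mono-q^ : ∀ a b S → mono a (q^ b · S) ≈ q^ b · mono a S
  mono-q^ a zero    S m k = refl
  mono-q^ a (suc b) S = ≈-trans (mono-q a _) (q-cong (mono-q^ a b S))

  mono-t : ∀ a S → mono a (t· S) ≈ t· mono a S
  mono-t a S = ≈-sym (q^t a (t· S))

  mono-mono : ∀ a b S → mono a (mono b S) ≈ mono b (mono a S)
  mono-mono a b S = ≈-trans (mono-q^ a b _) (q^-cong b (mono-t a S))

  factor-cong : ∀ a {S T} → S ≈ T → [1-q^ a t]· S ≈ [1-q^ a t]· T
  factor-cong a p = ⊖-cong p (mono-cong a p)

  interchange : ∀ (a b c d : ℤ) → (a + b) - (c + d) ≡ (a - c) + (b - d)
  interchange = solve-∀

  factor-⊕ : ∀ a S T → [1-q^ a t]· (S ⊕ T) ≈ [1-q^ a t]· S ⊕ [1-q^ a t]· T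
  factor-⊕ a S T m k =
    trans (cong (λ z → (S m k + T m k) - z) (mono-⊕ a S T m k)) (interchange (S m k) _ _ _)

  factor-mono : ∀ a b S → [1-q^ a t]· mono b S ≈ mono b ([1-q^ a t]· S)
  factor-mono a b S =
    ≈-trans (⊖-cong {S = mono b S} (λ _ _ → refl) (mono-mono a b S)) (≈-sym (mono-⊖ b S _))

  ∏-cong : ∀ a n {S T} → S ≈ T → ∏[1-q^t] a n S ≈ ∏[1-q^t] a n T
  ∏-cong a zero    p = p
  ∏-cong a (suc n) p = factor-cong a (∏-cong (suc a) n p)

  ∏-⊕ : ∀ a n S T → ∏[1-q^t] a n (S ⊕ T) ≈ ∏[1-q^t] a n S ⊕ ∏[1-q^t] a n T
  ∏-⊕ a zero    S T m k = refl
  ∏-⊕ a (suc n) S T = ≈-trans (factor-cong a (∏-⊕ (suc a) n S T)) (factor-⊕ a (∏[1-q^t] (suc a) n S) (∏[1-q^t] (suc a) n T))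

  ∏-mono : ∀ a n b S → ∏[1-q^t] a n (mono b S) ≈ mono b (∏[1-q^t] a n S)
  ∏-mono a zero    b S m k = refl
  ∏-mono a (suc n) b S = ≈-trans (factor-cong a (∏-mono (suc a) n b S)) (factor-mono a b _)

  factor-factor : ∀ a b S → [1-q^ a t]· [1-q^ b t]· S ≈ [1-q^ b t]· [1-q^ a t]· S
  factor-factor a b S m k =
    trans (cong (λ z → S m k - mono b S m k - z) (mono-⊖ a S (mono b S) m k))
    (trans (cong (λ z → S m k - mono b S m k - (mono a S m k - z)) (mono-mono a b S m k))
    (trans (swap (S m k) (mono b S m k) (mono a S m k) _)
           (cong (λ z → S m k - mono a S m k - z) (sym (mono-⊖ b S (mono a S) m k)))))
    where
    swap : ∀ (s x y z : ℤ) → s - x - (y - z) ≡ s - y - (x - z)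
    swap = solve-∀

  ∏-factor : ∀ a n b S → ∏[1-q^t] a n ([1-q^ b t]· S) ≈ [1-q^ b t]· ∏[1-q^t] a n S
  ∏-factor a zero    b S m k = refl
  ∏-factor a (suc n) b S = ≈-trans (factor-cong a (∏-factor (suc a) n b S)) (factor-factor a b (∏[1-q^t] (suc a) n S))

  poly-≈ : ∀ {S T} → S ≈ T → IsPolynomial S → IsPolynomial T
  poly-≈ p (N , h) = N , λ m k l → trans (sym (p m k)) (h m k l)

  poly-⊕ : ∀ {S T} → IsPolynomial S → IsPolynomial T → IsPolynomial (S ⊕ T)
  poly-⊕ (N , h) (M , g) = N ⊔ M , λ m k l →
    cong₂ _+_ (h m k (ℕₚ.≤-<-trans (ℕₚ.m≤m⊔n N M) l)) (g m k (ℕₚ.≤-<-trans (ℕₚ.m≤n⊔m N M) l))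

  poly-⊖ : ∀ {S T} → IsPolynomial S → IsPolynomial T → IsPolynomial (S ⊖ T)
  poly-⊖ (N , h) (M , g) = N ⊔ M , λ m k l →
    cong₂ _-_ (h m k (ℕₚ.≤-<-trans (ℕₚ.m≤m⊔n N M) l)) (g m k (ℕₚ.≤-<-trans (ℕₚ.m≤n⊔m N M) l))

  poly-q : ∀ {S} → IsPolynomial S → IsPolynomial (q· S)
  poly-q {S} (N , h) = suc N , go
    where
    go : ∀ m k → suc N < m +ℕ k → (q· S) m k ≡ 0ℤ
    go m zero    l = refl
    go m (suc k) l = h m k (s<s⁻¹ (subst (suc N <_) (ℕₚ.+-suc m k) l))

  poly-t : ∀ {S} → IsPolynomial S → IsPolynomial (t· S)
  poly-t {S} (N , h) = suc N , go
    where
    go : ∀ m k → suc N < m +ℕ k → (t· S) m k ≡ 0ℤ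
    go zero    k l = refl
    go (suc m) k l = h m k (s<s⁻¹ l)

  poly-q^ : ∀ a {S} → IsPolynomial S → IsPolynomial (q^ a · S)
  poly-q^ zero    p = p
  poly-q^ (suc a) p = poly-q (poly-q^ a p)

  poly-mono : ∀ a {S} → IsPolynomial S → IsPolynomial (mono a S)
  poly-mono a p = poly-q^ a (poly-t p)

  poly-factor : ∀ a {S} → IsPolynomial S → IsPolynomial ([1-q^ a t]· S)
  poly-factor a p = poly-⊖ p (poly-mono a p)

  poly-∏ : ∀ a n {S} → IsPolynomial S → IsPolynomial (∏[1-q^t] a n S)
  poly-∏ a zero    p = p
  poly-∏ a (suc n) p = poly-factor a (poly-∏ (suc a) n p)

  poly-𝟘 : IsPolynomial 𝟘
  poly-𝟘 = 0 , λ _ _ _ → refl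

  poly-𝟙 : IsPolynomial 𝟙
  poly-𝟙 = 0 , go
    where
    go : ∀ m k → 0 < m +ℕ k → 𝟙 m k ≡ 0ℤ
    go zero    (suc k) l = refl
    go (suc m) k       l = refl

  ⨁ : {A : Set} → List A → (A → Series) → Series
  ⨁ []       f = 𝟘
  ⨁ (x ∷ xs) f = f x ⊕ ⨁ xs f

  ⨁-cong : {A : Set} (xs : List A) {f g : A → Series} → (∀ {x} → x ∈ xs → f x ≈ g x) → ⨁ xs f ≈ ⨁ xs g
  ⨁-cong []       p m k = refl
  ⨁-cong (x ∷ xs) p = ⊕-cong (p (here refl)) (⨁-cong xs (p ∘ there))

  ∏-⨁ : {A : Set} (a n : ℕ) (xs : List A) (f : A → Series) →
         (∀ {x} → x ∈ xs → IsPolynomial (∏[1-q^t] a n (f x))) → IsPolynomial (∏[1-q^t] a n (⨁ xs f))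
  ∏-⨁ a n []       f p = poly-∏ a n poly-𝟘
  ∏-⨁ a n (x ∷ xs) f p =
    poly-≈ (≈-sym (∏-⊕ a n (f x) _)) (poly-⊕ (p (here refl)) (∏-⨁ a n xs f (p ∘ there)))

  count : {A : Set} {P : Pred A 0ℓ} → Decidable P → List A → ℕ
  count P? xs = length (filter P? xs)

  count-none : {A : Set} {P : Pred A 0ℓ} (P? : Decidable P) → (∀ x → ¬ P x) → ∀ xs → count P? xs ≡ 0
  count-none P? h []       = refl
  count-none P? h (x ∷ xs) with P? x
  ... | yes p = ⊥-elim (h x p)
  ... | no  _ = count-none P? h xs

  count-≐ : {A : Set} {P Q : Pred A 0ℓ} (P? : Decidable P) (Q? : Decidable Q) →
            (∀ {x} → P x → Q x) → (∀ {x} → Q x → P x) → ∀ xs → count P? xs ≡ count Q? xs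
  count-≐ P? Q? f g xs = cong length (filter-≐ P? Q? (f , g) xs)

  count-map : {A B : Set} {P : Pred B 0ℓ} (P? : Decidable P) (f : A → B) →
              ∀ xs → count P? (map f xs) ≡ count (P? ∘ f) xs
  count-map P? f []       = refl
  count-map P? f (x ∷ xs) with does (P? (f x))
  ... | true  = cong suc (count-map P? f xs)
  ... | false = count-map P? f xs

  module Chains (P : GradedPoset) where
    open GradedPoset P hiding (Carrier; elements; ρ; numeratorSeries)

    X : Set
    X = Carrier P

    els : List X
    els = elements P

    rk : X → ℕ
    rk = ρ P

    sumOver : ∀ {m} {Q : Pred (Vec X (suc m)) 0ℓ} (Q? : Decidable Q) (f : X → Series) (m′ k : ℕ) →
              (∀ x → + count (λ v → Q? (x ∷ v)) (tuples m) ≡ f x m′ k) →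
              ∀ xs → + count Q? (cartesianProductWith _∷_ xs (tuples m)) ≡ ⨁ xs f m′ k
    sumOver Q? f m′ k h []       = refl
    sumOver {m} Q? f m′ k h (x ∷ xs) =
      trans (cong (+_ ∘ length) (filter-++ Q? (map (x ∷_) (tuples m)) rest))
      (trans (cong +_ (length-++ (filter Q? (map (x ∷_) (tuples m)))))
      (cong₂ _+_ (trans (cong +_ (count-map Q? (x ∷_) (tuples m))) (h x))
                 (sumOver Q? f m′ k h xs)))
      where rest = cartesianProductWith _∷_ xs (tuples m)

    chain? : ∀ x k {m} (v : Vec X m) → Dec (Linked _⊑_ (x ∷ v) × totalRank v ≡ k)
    chain? x k v = linked? _⊑?_ (x ∷ v) ×-dec (totalRank v ≟ k)

    -- Weak chains with least element x, with and without x itself.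
    above from : X → Series
    above x m k = + count (chain? x k) (tuples m)
    from x = mono (rk x) (above x)

    fromCount : ∀ a x m k →
      + count (λ v → linked? _⊑?_ (x ∷ v) ×-dec (a +ℕ totalRank v ≟ k)) (tuples m) ≡ (q^ a · above x) m k
    fromCount zero    x m k       = refl
    fromCount (suc a) x m zero    = cong +_ (count-none _ (λ { _ (_ , ()) }) (tuples m))
    fromCount (suc a) x m (suc k) =
      trans (cong +_ (count-≐ _ _ (λ (p , e) → p , ℕₚ.suc-injective e) (λ (p , e) → p , cong suc e) (tuples m)))
            (fromCount a x m k)

    q^-t-suc : ∀ a S m k → (q^ a · t· S) (suc m) k ≡ (q^ a · S) m k
    q^-t-suc a S m k = sym (q^t a S (suc m) k)

    q^-t-zero : ∀ a S k → (q^ a · t· S) zero k ≡ 0ℤ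
    q^-t-zero a S k = sym (q^t a S zero k)

    fromCount′ : ∀ x m k →
      + count (λ v → linked? _⊑?_ (x ∷ v) ×-dec (totalRank (x ∷ v) ≟ k)) (tuples m) ≡ from x (suc m) k
    fromCount′ x m k = trans (fromCount (rk x) x m k) (sym (q^-t-suc (rk x) (above x) m k))

    ⨁-zero : ∀ {A : Set} (xs : List A) (f : A → Series) m k → (∀ x → f x m k ≡ 0ℤ) → ⨁ xs f m k ≡ 0ℤ
    ⨁-zero []       f m k p = refl
    ⨁-zero (x ∷ xs) f m k p = cong₂ _+_ (p x) (⨁-zero xs f m k p)

    zeta-from : zetaSeries ≈ 𝟙 ⊕ ⨁ els from
    zeta-from zero zero    =
      sym (cong (λ z → 1ℤ + z) (⨁-zero els from 0 0 (λ x → q^-t-zero (rk x) (above x) 0)))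
    zeta-from zero (suc k) =
      sym (cong (λ z → 0ℤ + z) (⨁-zero els from 0 (suc k) (λ x → q^-t-zero (rk x) (above x) (suc k))))
    zeta-from (suc m) k    =
      trans (sumOver _ from (suc m) k (λ x → fromCount′ x m k) els) (sym (ℤₚ.+-identityˡ _))

    gate : {Q : Set} → Dec Q → Series → Series
    gate d S = if does d then S else 𝟘

    weak strict : X → X → Series
    weak   x y = gate (x ⊑? y) (from y)
    strict x y = gate ((x ⊑? y) ×-dec ¬? (x ≡? y)) (from y)

    weak-zero : ∀ x y k → weak x y 0 k ≡ 0ℤ
    weak-zero x y k with does (x ⊑? y)
    ... | true  = q^-t-zero (rk y) (above y) k
    ... | false = refl

    step : ∀ x m k y →
      + count (λ v → chain? x k (y ∷ v)) (tuples m) ≡ weak x y (suc m) k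
    step x m k y with x ⊑? y
    ... | yes p = trans (cong +_ (count-≐ _ _ (λ { (_ ∷ l , e) → l , e }) (λ (l , e) → p ∷ l , e) (tuples m)))
                        (fromCount′ y m k)
    ... | no ¬p = cong +_ (count-none _ (λ { v (p ∷ _ , _) → ¬p p }) (tuples m))

    above-weak : ∀ x → above x ≈ 𝟙 ⊕ ⨁ els (weak x)
    above-weak x zero zero    = sym (cong (λ z → 1ℤ + z) (⨁-zero els (weak x) 0 0 (λ y → weak-zero x y 0)))
    above-weak x zero (suc k) = sym (cong (λ z → 0ℤ + z) (⨁-zero els (weak x) 0 (suc k) (λ y → weak-zero x y (suc k))))
    above-weak x (suc m) k    =
      trans (sumOver _ (weak x) (suc m) k (step x m k) els) (sym (ℤₚ.+-identityˡ _))

    weak≈strict : ∀ {x y} → x ≢ y → weak x y ≈ strict x y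
    weak≈strict {x} {y} x≢y with x ⊑? y | x ≡? y
    ... | _     | yes e = ⊥-elim (x≢y e)
    ... | yes _ | no _  = λ _ _ → refl
    ... | no _  | no _  = λ _ _ → refl

    weak-self : ∀ x → weak x x ≈ from x
    weak-self x with x ⊑? x
    ... | yes _ = λ _ _ → refl
    ... | no ¬p = ⊥-elim (¬p ⊑-refl)

    strict-self : ∀ x → strict x x ≈ 𝟘
    strict-self x with x ⊑? x | x ≡? x
    ... | _     | no ¬e = ⊥-elim (¬e refl)
    ... | yes _ | yes _ = λ _ _ → refl
    ... | no _  | yes _ = λ _ _ → refl

    split : ∀ x {xs} → Unique xs → x ∈ xs → ⨁ xs (weak x) ≈ from x ⊕ ⨁ xs (strict x)
    split x (x∉ ∷ u) (here {xs = xs} refl) =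
      ⊕-cong (weak-self x)
        (≈-trans (⨁-cong xs (λ y∈ → weak≈strict (All.lookup x∉ y∈)))
        (λ m k → sym (trans (cong (_+ ⨁ xs (strict x) m k) (strict-self x m k)) (ℤₚ.+-identityˡ _))))
    split x (y∉ ∷ u) (there {x = y} {xs = xs} x∈) m k =
      trans (cong₂ _+_ (weak≈strict (λ e → All.lookup y∉ x∈ (sym e)) m k) (split x u x∈ m k))
            (rot (strict x y m k) (from x m k) (⨁ xs (strict x) m k))
      where
      rot : ∀ (a b c : ℤ) → a + (b + c) ≡ b + (a + c)
      rot = solve-∀

    factor-from : ∀ {x} → x ∈ els → [1-q^ rk x t]· from x ≈ mono (rk x) (𝟙 ⊕ ⨁ els (strict x))
    factor-from {x} x∈ =
      ≈-trans (≈-sym (mono-⊖ (rk x) (above x) (from x))) (mono-cong (rk x) λ m k →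
        trans (cong (_- from x m k) (trans (above-weak x m k) (cong (λ z → 𝟙 m k + z) (split x unique x∈ m k))))
              (cancel (𝟙 m k) (from x m k) _))
      where
      cancel : ∀ (a b c : ℤ) → a + (b + c) - b ≡ a + c
      cancel = solve-∀

    rk≤max : ∀ {x} → x ∈ els → rk x ≤ maxRank
    rk≤max {x} x∈ with x ≡? top
    ... | yes e = ℕₚ.≤-reflexive (cong rk e)
    ... | no ¬e = ℕₚ.<⇒≤ (ρ-strict x∈ top∈ (⊑-top x∈) ¬e)

    from-poly : ∀ n a {x} → a +ℕ n ≡ suc maxRank → x ∈ els → a ≤ rk x → IsPolynomial (∏[1-q^t] a n (from x))
    from-poly zero a {x} e x∈ a≤ = ⊥-elim (ℕₚ.<⇒≱ (ℕₚ.n<1+n maxRank)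
      (ℕₚ.≤-trans (ℕₚ.≤-reflexive (trans (sym e) (ℕₚ.+-identityʳ a))) (ℕₚ.≤-trans a≤ (rk≤max x∈))))
    from-poly (suc n) a {x} e x∈ a≤ with a ≟ rk x
    ... | no a≢ = poly-factor a (from-poly n (suc a) (trans (sym (ℕₚ.+-suc a n)) e) x∈ (ℕₚ.≤∧≢⇒< a≤ a≢))
    ... | yes refl =
      poly-≈ (∏-factor (suc a) n a (from x))
      (poly-≈ (∏-cong (suc a) n (≈-sym (factor-from x∈)))
      (poly-≈ (≈-sym (∏-mono (suc a) n a _)) (poly-mono a
      (poly-≈ (≈-sym (∏-⊕ (suc a) n 𝟙 _)) (poly-⊕ (poly-∏ (suc a) n poly-𝟙)
      (∏-⨁ (suc a) n els (strict x) strict-poly))))))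
      where
      strict-poly : ∀ {y} → y ∈ els → IsPolynomial (∏[1-q^t] (suc a) n (strict x y))
      strict-poly {y} y∈ with x ⊑? y | x ≡? y
      ... | yes p | no x≢y = from-poly n (suc a) (trans (sym (ℕₚ.+-suc a n)) e) y∈ (ρ-strict x∈ y∈ p x≢y)
      ... | yes _ | yes _  = poly-∏ (suc a) n poly-𝟘
      ... | no _  | yes _  = poly-∏ (suc a) n poly-𝟘
      ... | no _  | no _   = poly-∏ (suc a) n poly-𝟘

open Polynomiality using (poly-≈; poly-⊕; poly-𝟙; poly-∏; ≈-sym; ∏-cong; ∏-⊕; ∏-⨁; 𝟙)

numerator-poly : (P : GradedPoset) → IsPolynomial (numeratorSeries P)
numerator-poly P =
  poly-≈ (∏-cong 0 N (≈-sym zeta-from))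
  (poly-≈ (≈-sym (∏-⊕ 0 N 𝟙 _)) (poly-⊕ (poly-∏ 0 N poly-𝟙)
  (∏-⨁ 0 N els from (λ x∈ → from-poly N 0 refl x∈ z≤n))))
  where
  open Polynomiality.Chains P
  N = suc (GradedPoset.maxRank P)

ℍ : GradedPoset → ℤ[q,t]
ℍ P = poly (numeratorSeries P) (numerator-poly P)

------------------------------------------------------------------------
-- Intervals

ρ-mono : (P : GradedPoset) → let open GradedPoset P using (_⊑_) in
         ∀ {x y} → x ∈ elements P → y ∈ elements P → x ⊑ y → ρ P x ≤ ρ P y
ρ-mono P {x} {y} x∈ y∈ x⊑y with GradedPoset._≡?_ P x y
... | yes refl = ℕₚ.≤-refl
... | no  x≢y  = ℕₚ.<⇒≤ (GradedPoset.ρ-strict P x∈ y∈ x⊑y x≢y)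

-- The interval [x,y] of P, with rank function z ↦ ρ z - ρ x.
interval : (P : GradedPoset) → let open GradedPoset P using (_⊑_) in
           ∀ {x y} → x ∈ elements P → y ∈ elements P → x ⊑ y → GradedPoset
interval P {x} {y} x∈ y∈ x⊑y = record
  { Carrier           = Carrier P
  ; _⊑_               = _⊑_
  ; isDecPartialOrder = isDecPartialOrder
  ; elements          = filter between? (elements P)
  ; unique            = Uniqueₚ.filter⁺ between? unique
  ; top               = y
  ; top∈              = ∈-filter⁺ between? y∈ (x⊑y , ⊑-refl)
  ; ⊑-top             = λ z∈ → proj₂ (proj₂ (split z∈))
  ; ρ                 = λ z → ρ P z ∸ ρ P x
  ; ρ-strict          = λ u∈ v∈ u⊑v u≢v →
      let u∈P , x⊑u , _ = split u∈
      in ℕₚ.∸-monoˡ-< (ρ-strict u∈P (proj₁ (split v∈)) u⊑v u≢v) (ρ-mono P x∈ u∈P x⊑u)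
  ; ρ-cover           = λ u∈ v∈ u⊑v u≢v cover →
      let u∈P , x⊑u , _   = split u∈
          v∈P , _   , v⊑y = split v∈
      in trans
        (cong (_∸ ρ P x) (ρ-cover u∈P v∈P u⊑v u≢v λ z∈ u⊑z z⊑v →
          cover (∈-filter⁺ between? z∈ (⊑-trans x⊑u u⊑z , ⊑-trans z⊑v v⊑y)) u⊑z z⊑v))
        (ℕₚ.+-∸-assoc 1 (ρ-mono P x∈ u∈P x⊑u))
  }
  where
  open GradedPoset P hiding (Carrier; elements; ρ; numeratorSeries)

  between? : Decidable (λ z → x ⊑ z × z ⊑ y)
  between? z = (x ⊑? z) ×-dec (z ⊑? y)

  split : ∀ {z} → z ∈ filter between? (elements P) → z ∈ elements P × x ⊑ z × z ⊑ y
  split = ∈-filter⁻ between?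

------------------------------------------------------------------------
-- Ferrers cells

-- Rows are indexed by Fin r, so i : Fin r is the row numbered suc (toℕ i). Since
-- bᵢ ≥ i ≥ 1, integer entries are natural numbers.
row : ∀ {r} → Fin r → ℕ
row i = suc (toℕ i)

record Boundary (r : ℕ) : Set where
  constructor boundary
  field
    entry         : Fin r → ℕ
    nonincreasing : ∀ {i j} → i Fin.≤ j → entry j ≤ entry i
    diagonal      : ∀ i → row i ≤ entry i
open Boundary public

Cell : ℕ → Set
Cell r = Fin r × ℕ

_≤ᶜ_ : ∀ {r} → Rel (Cell r) 0ℓ
(i , c) ≤ᶜ (j , d) = (j Fin.≤ i) × (c ≤ d)

InFerrers : ∀ {r} → Boundary r → Cell r → Set
InFerrers b (i , c) = row i ≤ c × c ≤ entry b i

inFerrers? : ∀ {r} (b : Boundary r) → Decidable (InFerrers b)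
inFerrers? b (i , c) = (row i ≤? c) ×-dec (c ≤? entry b i)

≤ᶜ-isDecPartialOrder : ∀ {r} → IsDecPartialOrder _≡_ (_≤ᶜ_ {r})
≤ᶜ-isDecPartialOrder = record
  { isPartialOrder = record
    { isPreorder = record
      { isEquivalence = isEquivalence
      ; reflexive     = λ { refl → ℕₚ.≤-refl , ℕₚ.≤-refl }
      ; trans         = λ (p , q) (p′ , q′) → ℕₚ.≤-trans p′ p , ℕₚ.≤-trans q q′
      }
    ; antisym = λ (p , q) (p′ , q′) → cong₂ _,_ (toℕ-injective (ℕₚ.≤-antisym p′ p)) (ℕₚ.≤-antisym q q′)
    }
  ; _≟_  = ≡-dec Finₚ._≟_ _≟_
  ; _≤?_ = λ (i , c) (j , d) → (j Finₚ.≤? i) ×-dec (c ≤? d)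
  }

-- Every entry is at most the first one, so the bounding box contains every cell.
cells : ∀ {n} → Boundary (suc n) → List (Cell (suc n))
cells b = filter (inFerrers? b) (cartesianProduct (allFin _) (upTo (suc (entry b zero))))

∈-cells⁺ : ∀ {n} (b : Boundary (suc n)) {z} → InFerrers b z → z ∈ cells b
∈-cells⁺ b {i , c} p = ∈-filter⁺ (inFerrers? b)
  (∈-cartesianProduct⁺ (∈-allFin i) (∈-upTo⁺ (s≤s (ℕₚ.≤-trans (proj₂ p) (nonincreasing b z≤n))))) p

∈-cells⁻ : ∀ {n} (b : Boundary (suc n)) {z} → z ∈ cells b → InFerrers b z
∈-cells⁻ b z∈ = proj₂ (∈-filter⁻ (inFerrers? b)
  {xs = cartesianProduct (allFin _) (upTo (suc (entry b zero)))} z∈)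

cellRank : ∀ {r} → Cell r → ℕ
cellRank (i , c) = c ∸ row i

cellRank-strict : ∀ {r} (b : Boundary r) {x y : Cell r} → InFerrers b x → InFerrers b y →
                  x ≤ᶜ y → x ≢ y → cellRank x < cellRank y
cellRank-strict b {i , c} {j , d} (i≤c , _) (j≤d , _) (j≤i , c≤d) x≢y with c ≟ d
... | no c≢d = ℕₚ.<-≤-trans (ℕₚ.∸-monoˡ-< (ℕₚ.≤∧≢⇒< c≤d c≢d) i≤c) (ℕₚ.∸-monoʳ-≤ d (s≤s j≤i))
... | yes refl = ℕₚ.∸-monoʳ-< (s≤s (ℕₚ.≤∧≢⇒< j≤i (λ e → x≢y (cong (_, c) (sym (toℕ-injective e)))))) i≤c

cellRank-cover : ∀ {r} (b : Boundary r) {x y : Cell r} → InFerrers b x → InFerrers b y →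
                 x ≤ᶜ y → x ≢ y →
                 (∀ {z} → InFerrers b z → x ≤ᶜ z → z ≤ᶜ y → z ≡ x ⊎ z ≡ y) →
                 cellRank y ≡ suc (cellRank x)
cellRank-cover b {i , c} {j , d} (i≤c , c≤b) (j≤d , d≤b) (j≤i , c≤d) x≢y cover with j Finₚ.≟ i
... | yes refl with cover {i , suc c} (ℕₚ.m≤n⇒m≤1+n i≤c , ℕₚ.≤-trans c<d d≤b)
                          (ℕₚ.≤-refl , ℕₚ.n≤1+n c) (ℕₚ.≤-refl , c<d)
  where
  c<d : c < d
  c<d = ℕₚ.≤∧≢⇒< c≤d (λ e → x≢y (cong (i ,_) e))
...   | inj₁ ()
...   | inj₂ refl = ℕₚ.+-∸-assoc 1 i≤c
cellRank-cover b {suc i , c} {j , d} (i≤c , c≤b) (j≤d , d≤b) (j≤i , c≤d) x≢y cover | no j≢i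
  with cover {inject₁ i , c}
         (subst (λ k → suc k ≤ c) (sym (toℕ-inject₁ i)) (ℕₚ.<⇒≤ i≤c) , ℕₚ.≤-trans c≤b (nonincreasing b i≤1+i))
         (i≤1+i , ℕₚ.≤-refl) (j≤i′ , c≤d)
  where
  i≤1+i : toℕ (inject₁ i) ≤ suc (toℕ i)
  i≤1+i = subst (_≤ suc (toℕ i)) (sym (toℕ-inject₁ i)) (ℕₚ.n≤1+n _)
  j≤i′ : toℕ j ≤ toℕ (inject₁ i)
  j≤i′ = subst (toℕ j ≤_) (sym (toℕ-inject₁ i)) (s≤s⁻¹ (ℕₚ.≤∧≢⇒< j≤i (j≢i ∘ toℕ-injective)))
... | inj₁ e = ⊥-elim (ℕₚ.1+n≢n (trans (sym (cong (toℕ ∘ proj₁) e)) (toℕ-inject₁ i)))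
... | inj₂ refl rewrite toℕ-inject₁ i = ℕₚ.+-∸-assoc 1 i≤c
cellRank-cover b {zero , c} {zero , d} _ _ _ _ _ | no j≢i = ⊥-elim (j≢i refl)

F : ∀ {n} → Boundary (suc n) → GradedPoset
F b = record
  { Carrier           = Cell _
  ; _⊑_               = _≤ᶜ_
  ; isDecPartialOrder = ≤ᶜ-isDecPartialOrder
  ; elements          = cells b
  ; unique            = Uniqueₚ.filter⁺ (inFerrers? b)
                          (Uniqueₚ.cartesianProduct⁺ (Uniqueₚ.allFin⁺ _) (Uniqueₚ.upTo⁺ (suc (entry b zero))))
  ; top               = zero , entry b zero
  ; top∈              = ∈-cells⁺ b (diagonal b zero , ℕₚ.≤-refl)
  ; ⊑-top             = λ z∈ → z≤n , ℕₚ.≤-trans (proj₂ (∈-cells⁻ b z∈)) (nonincreasing b z≤n)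
  ; ρ                 = cellRank
  ; ρ-strict          = λ x∈ y∈ → cellRank-strict b (∈-cells⁻ b x∈) (∈-cells⁻ b y∈)
  ; ρ-cover           = λ x∈ y∈ x≤y x≢y cover →
      cellRank-cover b (∈-cells⁻ b x∈) (∈-cells⁻ b y∈) x≤y x≢y (λ z∈ → cover (∈-cells⁺ b z∈))
  }

-- (b₁, r, …, r) and (b₁, …, b₁), where r = suc n.
lowest highest : ∀ {n} b₁ → suc n ≤ b₁ → Boundary (suc n)
lowest {n} b₁ r≤b₁ = boundary e mono-e diag
  where
  e : Fin (suc n) → ℕ
  e zero    = b₁
  e (suc _) = suc n
  mono-e : ∀ {i j} → i Fin.≤ j → e j ≤ e i
  mono-e {zero}  {zero}  _ = ℕₚ.≤-refl
  mono-e {zero}  {suc _} _ = r≤b₁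
  mono-e {suc _} {suc _} _ = ℕₚ.≤-refl
  diag : ∀ i → row i ≤ e i
  diag zero    = ℕₚ.≤-trans (s≤s z≤n) r≤b₁
  diag (suc i) = Finₚ.toℕ<n (suc i)
highest b₁ r≤b₁ = boundary (λ _ → b₁) (λ _ → ℕₚ.≤-refl) (λ i → ℕₚ.≤-trans (Finₚ.toℕ<n i) r≤b₁)

{-# OPTIONS --safe #-}
module Submission where

-- Measure cells by their distance from the top: k rows below it and f columns to its
-- left. Let W k f be 1 plus the generating function of the weak chains whose least
-- element lies in a row < k at column distance ≤ f, and R k f that of the chains whose
-- least element lies in row k at column distance < f. If the cell (k , f) has rank a,
-- then
--   (1 - qᵃ t) R k (f + 1) = R k f + qᵃ t W k f,
--   (1 - qᵃ t) W (k + 1) f = W k f + R k f.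
-- After multiplication by the factors 1 - qᵇ t with b > a these become recurrences
-- without subtraction, so a numerator enumerates lattice paths inside the shape, weighted
-- by their turns from east to north. A larger shape with the same top
-- has more paths.

open import Defs
open import Data.Bool using (if_then_else_)
open import Data.Empty using (⊥-elim)
open import Data.Fin using (Fin; zero; suc; toℕ; fromℕ<)
import Data.Fin as Fin
import Data.Fin.Properties as Finₚ
open import Data.Integer using (ℤ; 0ℤ; _+_; _-_; +≤+) renaming (_≤_ to _≤ℤ_)
import Data.Integer.Properties as ℤₚ
open import Data.Integer.Tactic.RingSolver using (solve-∀)
import Data.Nat.Tactic.RingSolver as ℕ-RingSolver
open import Data.List using (List; []; _∷_)
open import Data.List.Membership.Propositional using (_∈_)
open import Data.List.Membership.Propositional.Properties using (∈-filter⁺; ∈-filter⁻)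
import Data.List.Relation.Unary.All as All
open import Data.List.Relation.Unary.AllPairs using ([]; _∷_)
open import Data.List.Relation.Unary.Any using (here; there)
open import Data.List.Relation.Unary.Unique.Propositional using (Unique)
open import Data.Nat using (ℕ; zero; suc; pred; _∸_; _⊓_; _≤_; _<_; _≤?_; _<?_; _≟_; z≤n; s≤s; s≤s⁻¹)
  renaming (_+_ to _+ℕ_)
import Data.Nat.Properties as ℕₚ
open import Data.Product using (_×_; _,_; proj₁; proj₂; ∃-syntax)
open import Data.Sum using (_⊎_; inj₁; inj₂; [_,_])
open import Function using (_∘_; _⇔_; mk⇔; Equivalence)
open import Relation.Binary using (Setoid)
import Relation.Binary.Reasoning.Setoid as SetoidReasoning
open import Relation.Binary.PropositionalEquality hiding ([_])
open import Relation.Nullary using (yes; no; ¬_)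
open import Relation.Nullary.Decidable using (_×-dec_; does-⇔)
open import Relation.Unary using (Pred; Decidable)
open import Level using (0ℓ)
open GradedPoset using (Carrier; elements; ρ; numeratorSeries; maxRank)
open Polynomiality hiding (module Chains)

-- Zero series and the coefficientwise order on series.

≈-setoid : Setoid 0ℓ 0ℓ
≈-setoid = record
  { Carrier       = Series
  ; _≈_           = _≈_
  ; isEquivalence = record
    { refl  = λ _ _ → refl
    ; sym   = λ p m k → sym (p m k)
    ; trans = λ p q m k → trans (p m k) (q m k)
    }
  }

open SetoidReasoning ≈-setoid

mono-𝟘 : ∀ a → mono a 𝟘 ≈ 𝟘
mono-𝟘 zero    zero    k       = refl
mono-𝟘 zero    (suc m) k       = refl
mono-𝟘 (suc a) m       zero    = refl
mono-𝟘 (suc a) m       (suc k) = mono-𝟘 a m k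

∏-𝟘 : ∀ a n → ∏[1-q^t] a n 𝟘 ≈ 𝟘
∏-𝟘 a zero    m k = refl
∏-𝟘 a (suc n) m k = trans (factor-cong a (∏-𝟘 (suc a) n) m k) (cong (0ℤ -_) (mono-𝟘 a m k))

infix 4 _⊴_
_⊴_ : Series → Series → Set
S ⊴ T = ∀ m k → S m k ≤ℤ T m k

⊕-mono-⊴ : ∀ {S S′ T T′} → S ⊴ S′ → T ⊴ T′ → S ⊕ T ⊴ S′ ⊕ T′
⊕-mono-⊴ p q m k = ℤₚ.+-mono-≤ (p m k) (q m k)

mono-⊴ : ∀ a {S T} → S ⊴ T → mono a S ⊴ mono a T
mono-⊴ zero    p zero    k = ℤₚ.≤-refl
mono-⊴ zero    p (suc m) k = p m k
mono-⊴ (suc a) p m zero    = ℤₚ.≤-refl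
mono-⊴ (suc a) p m (suc k) = mono-⊴ a p m k

𝟘⊴mono : ∀ a {S} → 𝟘 ⊴ S → 𝟘 ⊴ mono a S
𝟘⊴mono a {S} p m k = subst (_≤ℤ mono a S m k) (mono-𝟘 a m k) (mono-⊴ a p m k)

𝟘⊴𝟙 : 𝟘 ⊴ 𝟙
𝟘⊴𝟙 zero    zero    = +≤+ z≤n
𝟘⊴𝟙 zero    (suc k) = ℤₚ.≤-refl
𝟘⊴𝟙 (suc m) k       = ℤₚ.≤-refl

-- Turn-weighted lattice paths and their dependence on the shape.

-- H is the maximal rank. The cell (k , f) lies in row k (counted from 0), f columns left
-- of the top, and row k of the shape begins at f = gap k. `paths gap k f` enumerates the
-- lattice paths from (k , f) to the top (0 , 0), weighted by the product of qᵃ t over the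
-- ranks a of the turns from a row step (f decreases) to a column step (k decreases).
-- `east gap k f` enumerates those from (suc k , f) whose first step is a row step.
module Paths (H : ℕ) where

  paths east : (gap : ℕ → ℕ) → ℕ → ℕ → Series
  paths gap zero    f = 𝟙
  paths gap (suc k) f = paths gap k f ⊕ east gap k f
  east gap k zero    = 𝟘
  east gap k (suc f) with gap (suc k) ≤? f
  ... | yes _ = east gap k f ⊕ mono (H ∸ (suc k +ℕ f)) (paths gap k f)
  ... | no  _ = 𝟘

  -- A path starts in a cell (suc k , H ∸ suc k) of rank 0; it is prolonged backwards by a
  -- row step, which makes an initial column step count as a turn.
  totalPaths : (gap : ℕ → ℕ) → ℕ → Series
  totalPaths gap zero    = 𝟙
  totalPaths gap (suc k) = totalPaths gap k ⊕ east gap k (H ∸ k)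

  paths-nonneg : ∀ gap k f → 𝟘 ⊴ paths gap k f
  east-nonneg : ∀ gap k f → 𝟘 ⊴ east gap k f
  paths-nonneg gap zero    f = 𝟘⊴𝟙
  paths-nonneg gap (suc k) f = ⊕-mono-⊴ (paths-nonneg gap k f) (east-nonneg gap k f)
  east-nonneg gap k zero    m l = ℤₚ.≤-refl
  east-nonneg gap k (suc f) with gap (suc k) ≤? f
  ... | yes _ = ⊕-mono-⊴ (east-nonneg gap k f) (𝟘⊴mono (H ∸ (suc k +ℕ f)) (paths-nonneg gap k f))
  ... | no  _ = λ _ _ → ℤₚ.≤-refl

  module _ {gap gap′ : ℕ → ℕ} (gap′≤gap : ∀ k → gap′ k ≤ gap k) where
    -- Lowering the gap can only replace a value `𝟘` of `east` by a nonnegative sum; the recurrences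
    -- themselves have no subtraction.
    paths-antitone : ∀ k f → paths gap k f ⊴ paths gap′ k f
    east-antitone : ∀ k f → east gap k f ⊴ east gap′ k f
    paths-antitone zero    f m l = ℤₚ.≤-refl
    paths-antitone (suc k) f = ⊕-mono-⊴ (paths-antitone k f) (east-antitone k f)
    east-antitone k zero    m l = ℤₚ.≤-refl
    east-antitone k (suc f) with gap (suc k) ≤? f | gap′ (suc k) ≤? f
    ... | yes _ | yes _ = ⊕-mono-⊴ (east-antitone k f) (mono-⊴ (H ∸ (suc k +ℕ f)) (paths-antitone k f))
    ... | yes p | no ¬p = ⊥-elim (¬p (ℕₚ.≤-trans (gap′≤gap (suc k)) p))
    ... | no  _ | yes _ = ⊕-mono-⊴ (east-nonneg gap′ k f) (𝟘⊴mono (H ∸ (suc k +ℕ f)) (paths-nonneg gap′ k f))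
    ... | no  _ | no  _ = λ _ _ → ℤₚ.≤-refl

    totalPaths-antitone : ∀ k → totalPaths gap k ⊴ totalPaths gap′ k
    totalPaths-antitone zero    m l = ℤₚ.≤-refl
    totalPaths-antitone (suc k) = ⊕-mono-⊴ (totalPaths-antitone k) (east-antitone k (H ∸ k))

-- Coordinates, common to whole shapes and their intervals.

-- An order-reversing embedding into ℕ × ℕ, so that the top has coordinates (0 , 0).
record Coordinates (P : GradedPoset) (gap : ℕ → ℕ) : Set where
  open GradedPoset P using (_⊑_)
  field
    κ φ      : Carrier P → ℕ
    ⊑⇔       : ∀ {x y} → x ∈ elements P → y ∈ elements P → x ⊑ y ⇔ (κ y ≤ κ x × φ y ≤ φ x)
    rank     : ∀ {x} → x ∈ elements P → ρ P x +ℕ (κ x +ℕ φ x) ≡ maxRank P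
    gap≤     : ∀ {x} → x ∈ elements P → gap (κ x) ≤ φ x
    gap-mono : ∀ {k l} → k ≤ l → gap k ≤ gap l
    fill     : ∀ {x k f} → x ∈ elements P → k ≤ κ x → f ≤ φ x → gap k ≤ f →
               ∃[ z ] z ∈ elements P × κ z ≡ k × φ z ≡ f

-- Sums of chain series over sets of least elements.

module Numerator {P : GradedPoset} {gap : ℕ → ℕ} (coords : Coordinates P gap) where
  open Coordinates coords
  open GradedPoset P using (_⊑_; _⊑?_; _≡?_; ⊑-antisym; unique; top; top∈; zetaSeries)
  open Polynomiality.Chains P

  H : ℕ
  H = maxRank P

  open Paths H

  -- The generating function of the nonempty weak chains whose least element satisfies Q.
  ∑[_] : {Q : Pred X 0ℓ} → Decidable Q → Series
  ∑[ Q? ] = ⨁ els (λ y → gate (Q? y) (from y))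

  ⨁-⊕ : ∀ (xs : List X) f g → ⨁ xs (λ y → f y ⊕ g y) ≈ ⨁ xs f ⊕ ⨁ xs g
  ⨁-⊕ []       f g m k = refl
  ⨁-⊕ (x ∷ xs) f g m k =
    trans (cong (λ z → f x m k + g x m k + z) (⨁-⊕ xs f g m k)) (interchange₊ (f x m k) _ _ _)
    where
    interchange₊ : ∀ (a b c d : ℤ) → a + b + (c + d) ≡ a + c + (b + d)
    interchange₊ = solve-∀

  ⨁-𝟘 : ∀ (xs : List X) → ⨁ xs (λ _ → 𝟘) ≈ 𝟘
  ⨁-𝟘 xs m k = ⨁-zero xs _ m k (λ _ → refl)

  ∑-partition : {Q R S : Pred X 0ℓ} (Q? : Decidable Q) (R? : Decidable R) (S? : Decidable S) →
                (∀ {y} → y ∈ els → Q y ⇔ (R y ⊎ S y)) → (∀ {y} → y ∈ els → R y → ¬ S y) →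
                ∑[ Q? ] ≈ ∑[ R? ] ⊕ ∑[ S? ]
  ∑-partition {Q} {R} {S} Q? R? S? cover disjoint = ≈-trans (⨁-cong els pointwise) (⨁-⊕ els _ _)
    where
    pointwise : ∀ {y} → y ∈ els → gate (Q? y) (from y) ≈ gate (R? y) (from y) ⊕ gate (S? y) (from y)
    pointwise {y} y∈ with Q? y | R? y | S? y
    ... | _     | yes r | yes s = ⊥-elim (disjoint y∈ r s)
    ... | yes _ | yes _ | no _  = λ _ _ → sym (ℤₚ.+-identityʳ _)
    ... | yes _ | no _  | yes _ = λ _ _ → sym (ℤₚ.+-identityˡ _)
    ... | yes q | no ¬r | no ¬s = ⊥-elim ([ ¬r , ¬s ] (Equivalence.to (cover y∈) q))
    ... | no ¬q | yes r | no _  = ⊥-elim (¬q (Equivalence.from (cover y∈) (inj₁ r)))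
    ... | no ¬q | no _  | yes s = ⊥-elim (¬q (Equivalence.from (cover y∈) (inj₂ s)))
    ... | no _  | no _  | no _  = λ _ _ → refl

  ∑-cong : {Q R : Pred X 0ℓ} (Q? : Decidable Q) (R? : Decidable R) →
           (∀ {y} → y ∈ els → Q y ⇔ R y) → ∑[ Q? ] ≈ ∑[ R? ]
  ∑-cong Q? R? eq = ⨁-cong els λ {y} y∈ m k →
    cong (λ b → (if b then from y else 𝟘) m k) (does-⇔ (eq y∈) (Q? y) (R? y))

  ∑-none : {Q : Pred X 0ℓ} (Q? : Decidable Q) → (∀ {y} → y ∈ els → ¬ Q y) → ∑[ Q? ] ≈ 𝟘
  ∑-none Q? none = ≈-trans (⨁-cong els pointwise) (⨁-𝟘 els)
    where
    pointwise : ∀ {y} → y ∈ els → gate (Q? y) (from y) ≈ 𝟘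
    pointwise {y} y∈ with Q? y
    ... | yes q = ⊥-elim (none y∈ q)
    ... | no  _ = λ _ _ → refl

  ∑-all : {Q : Pred X 0ℓ} (Q? : Decidable Q) → (∀ {y} → y ∈ els → Q y) → ∑[ Q? ] ≈ ⨁ els from
  ∑-all Q? all = ⨁-cong els pointwise
    where
    pointwise : ∀ {y} → y ∈ els → gate (Q? y) (from y) ≈ from y
    pointwise {y} y∈ with Q? y
    ... | yes _ = λ _ _ → refl
    ... | no ¬q = ⊥-elim (¬q (all y∈))

  ∑-singleton : ∀ {x} → x ∈ els → ∑[ x ≡?_ ] ≈ from x
  ∑-singleton {x} = go unique
    where
    hit : gate (x ≡? x) (from x) ≈ from x
    hit with x ≡? x
    ... | yes _ = λ _ _ → refl
    ... | no ¬e = ⊥-elim (¬e refl)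
    miss : ∀ {y} → x ≢ y → gate (x ≡? y) (from y) ≈ 𝟘
    miss {y} x≢y with x ≡? y
    ... | yes e = ⊥-elim (x≢y e)
    ... | no _  = λ _ _ → refl
    go : ∀ {xs} → Unique xs → x ∈ xs → ⨁ xs (λ y → gate (x ≡? y) (from y)) ≈ from x
    go {xs = _ ∷ xs} (x∉ ∷ u) (here refl) m k =
      trans (cong₂ _+_ (hit m k) (trans (⨁-cong xs (λ y∈ → miss (All.lookup x∉ y∈)) m k) (⨁-𝟘 xs m k)))
            (ℤₚ.+-identityʳ _)
    go (y∉ ∷ u) (there x∈) m k =
      trans (cong₂ _+_ (miss (λ e → All.lookup y∉ x∈ (sym e)) m k) (go u x∈ m k)) (ℤₚ.+-identityˡ _)

  -- Row sums and their recurrences.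

  inRow? : ∀ k f → Decidable (λ y → κ y ≡ k × φ y < f)
  inRow? k f y = (κ y ≟ k) ×-dec (φ y <? f)

  inRows? : ∀ k f → Decidable (λ y → κ y < k × φ y ≤ f)
  inRows? k f y = (κ y <? k) ×-dec (φ y ≤? f)

  -- These are R and W of the opening comment; `𝟙` accounts for the empty chain.
  rowSum rowsSum : ℕ → ℕ → Series
  rowSum  k f = ∑[ inRow? k f ]
  rowsSum k f = 𝟙 ⊕ ∑[ inRows? k f ]

  rowsSum-zero : ∀ f → rowsSum 0 f ≈ 𝟙
  rowsSum-zero f m k =
    trans (cong (𝟙 m k +_) (∑-none (inRows? 0 f) (λ { _ (() , _) }) m k)) (ℤₚ.+-identityʳ _)

  rowsSum-suc : ∀ k f → rowsSum (suc k) f ≈ rowsSum k f ⊕ rowSum k (suc f)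
  rowsSum-suc k f m l =
    trans (cong (𝟙 m l +_) (∑-partition (inRows? (suc k) f) (inRows? k f) (inRow? k (suc f))
            (λ _ → mk⇔ to from′) (λ _ (a , _) (b , _) → ℕₚ.<⇒≢ a b) m l))
          (sym (ℤₚ.+-assoc (𝟙 m l) _ _))
    where
    to : ∀ {y} → κ y < suc k × φ y ≤ f → (κ y < k × φ y ≤ f) ⊎ (κ y ≡ k × φ y < suc f)
    to (a , b) with ℕₚ.m≤n⇒m<n∨m≡n (s≤s⁻¹ a)
    ... | inj₁ c = inj₁ (c , b)
    ... | inj₂ c = inj₂ (c , s≤s b)
    from′ : ∀ {y} → (κ y < k × φ y ≤ f) ⊎ (κ y ≡ k × φ y < suc f) → κ y < suc k × φ y ≤ f
    from′ (inj₁ (a , b)) = ℕₚ.m<n⇒m<1+n a , b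
    from′ (inj₂ (a , b)) = s≤s (ℕₚ.≤-reflexive a) , s≤s⁻¹ b

  coordinates-injective : ∀ {x y} → x ∈ els → y ∈ els → κ x ≡ κ y → φ x ≡ φ y → x ≡ y
  coordinates-injective x∈ y∈ a b = ⊑-antisym
    (Equivalence.from (⊑⇔ x∈ y∈) (ℕₚ.≤-reflexive (sym a) , ℕₚ.≤-reflexive (sym b)))
    (Equivalence.from (⊑⇔ y∈ x∈) (ℕₚ.≤-reflexive a , ℕₚ.≤-reflexive b))

  rowSum-suc : ∀ {x} → x ∈ els → rowSum (κ x) (suc (φ x)) ≈ rowSum (κ x) (φ x) ⊕ from x
  rowSum-suc {x} x∈ = ≈-trans
    (∑-partition (inRow? (κ x) (suc (φ x))) (inRow? (κ x) (φ x)) (x ≡?_)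
       (λ y∈ → mk⇔ (to y∈) from′) (λ { _ (_ , b) refl → ℕₚ.<-irrefl refl b }))
    (⊕-cong {S = rowSum (κ x) (φ x)} (λ _ _ → refl) (∑-singleton x∈))
    where
    to : ∀ {y} → y ∈ els → κ y ≡ κ x × φ y < suc (φ x) → (κ y ≡ κ x × φ y < φ x) ⊎ x ≡ y
    to y∈ (a , b) with ℕₚ.m≤n⇒m<n∨m≡n (s≤s⁻¹ b)
    ... | inj₁ c = inj₁ (a , c)
    ... | inj₂ c = inj₂ (coordinates-injective x∈ y∈ (sym a) (sym c))
    from′ : ∀ {y} → (κ y ≡ κ x × φ y < φ x) ⊎ x ≡ y → κ y ≡ κ x × φ y < suc (φ x)
    from′ (inj₁ (a , b)) = a , ℕₚ.m<n⇒m<1+n b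
    from′ (inj₂ refl)    = refl , ℕₚ.≤-refl

  rowSum-empty : ∀ k f → f ≤ gap k → rowSum k f ≈ 𝟘
  rowSum-empty k f f≤ = ∑-none (inRow? k f)
    λ { y∈ (refl , b) → ℕₚ.<⇒≱ b (ℕₚ.≤-trans f≤ (gap≤ y∈)) }

  -- The elements above x fill the rectangle between x and the top, so what follows x in a chain is
  -- empty or starts there.
  above≈rowsSum : ∀ {x} → x ∈ els → above x ≈ rowsSum (suc (κ x)) (φ x)
  above≈rowsSum {x} x∈ = ≈-trans (above-weak x)
    (⊕-cong {S = 𝟙} (λ _ _ → refl) (∑-cong (x ⊑?_) (inRows? (suc (κ x)) (φ x))
      λ y∈ → mk⇔ (λ p → let a , b = Equivalence.to (⊑⇔ x∈ y∈) p in s≤s a , b)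
                 (λ (a , b) → Equivalence.from (⊑⇔ x∈ y∈) (s≤s⁻¹ a , b))))

  -- The only new least element is x. Its chains contribute qᵃ t times `W` plus qᵃ t times the
  -- enlarged row sum, and the factor cancels the latter.
  factor-rowSum : ∀ {x} → x ∈ els →
    [1-q^ rk x t]· rowSum (κ x) (suc (φ x)) ≈ rowSum (κ x) (φ x) ⊕ mono (rk x) (rowsSum (κ x) (φ x))
  factor-rowSum {x} x∈ m l =
    trans (cong₂ _-_ (trans (rowSum-suc x∈ m l) (cong (R m l +_) (from-split m l)))
                     (mono-cong a (rowSum-suc x∈) m l))
          (cancel (R m l) (mono a W m l) (mono a (R ⊕ from x) m l))
    where
    a = rk x
    R = rowSum (κ x) (φ x)
    W = rowsSum (κ x) (φ x)
    from-split : from x ≈ mono a W ⊕ mono a (R ⊕ from x)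
    from-split = ≈-trans
      (mono-cong a (≈-trans (above≈rowsSum x∈) (≈-trans (rowsSum-suc (κ x) (φ x))
        (⊕-cong {S = W} (λ _ _ → refl) (rowSum-suc x∈)))))
      (mono-⊕ a W _)
    cancel : ∀ (r w z : ℤ) → r + (w + z) - z ≡ r + w
    cancel = solve-∀

  -- The term `mono a W` subtracted by the factor comes back from `factor-rowSum` applied to the
  -- added row.
  factor-rowsSum : ∀ {x} → x ∈ els →
    [1-q^ rk x t]· rowsSum (suc (κ x)) (φ x) ≈ rowsSum (κ x) (φ x) ⊕ rowSum (κ x) (φ x)
  factor-rowsSum {x} x∈ m l =
    trans (factor-cong a (rowsSum-suc (κ x) (φ x)) m l)
    (trans (factor-⊕ a W _ m l)
    (trans (cong (W m l - mono a W m l +_) (factor-rowSum x∈ m l))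
           (cancel (W m l) (mono a W m l) _)))
    where
    a = rk x
    W = rowsSum (κ x) (φ x)
    cancel : ∀ (w z r : ℤ) → w - z + (r + z) ≡ w + r
    cancel = solve-∀

  -- Clearing denominators.

  -- The n factors of highest index.
  Π : ℕ → Series → Series
  Π n = ∏[1-q^t] (suc H ∸ n) n

  Π-cong : ∀ n {S T} → S ≈ T → Π n S ≈ Π n T
  Π-cong n = ∏-cong (suc H ∸ n) n

  Π-⊕ : ∀ n S T → Π n (S ⊕ T) ≈ Π n S ⊕ Π n T
  Π-⊕ n = ∏-⊕ (suc H ∸ n) n

  Π-suc : ∀ n S → n ≤ H → Π (suc n) S ≡ [1-q^ H ∸ n t]· Π n S
  Π-suc n S n≤H = cong (λ a → [1-q^ H ∸ n t]· ∏[1-q^t] a n S) (sym (ℕₚ.+-∸-assoc 1 n≤H))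

  rk≡ : ∀ {x} → x ∈ els → rk x ≡ H ∸ (κ x +ℕ φ x)
  rk≡ {x} x∈ = sym (trans (cong (_∸ (κ x +ℕ φ x)) (sym (rank x∈))) (ℕₚ.m+n∸n≡m (rk x) (κ x +ℕ φ x)))

  κ+φ≤H : ∀ {x} → x ∈ els → κ x +ℕ φ x ≤ H
  κ+φ≤H {x} x∈ = subst (κ x +ℕ φ x ≤_) (rank x∈) (ℕₚ.m≤n+m _ (rk x))

  -- Since x has rank H - (κ x + φ x), the factor gained in passing to `suc (κ x +ℕ φ x)` is the one
  -- for x. It commutes past the others and acts on S directly.
  Π-at : ∀ {x} → x ∈ els → ∀ {S T} → [1-q^ rk x t]· S ≈ T →
         Π (suc (κ x +ℕ φ x)) S ≈ Π (κ x +ℕ φ x) T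
  Π-at {x} x∈ {S} {T} p = begin
    Π (suc n) S             ≡⟨ Π-suc n S (κ+φ≤H x∈) ⟩
    [1-q^ H ∸ n t]· Π n S   ≡⟨ cong (λ a → [1-q^ a t]· Π n S) (sym (rk≡ x∈)) ⟩
    [1-q^ rk x t]· Π n S    ≈⟨ ∏-factor (suc H ∸ n) n (rk x) S ⟨
    Π n ([1-q^ rk x t]· S)  ≈⟨ Π-cong n p ⟩
    Π n T                   ∎
    where n = κ x +ℕ φ x

  -- Least elements counted here have κ + φ < k + f, hence rank above H - (k + f). For k + f ≤ H +
  -- 1, `Π (k +ℕ f)` consists of the factors for exactly these ranks.
  rowNum rowsNum : ℕ → ℕ → Series
  rowNum  k f = Π (k +ℕ f) (rowSum k f)
  rowsNum k f = Π (k +ℕ f) (rowsSum k f)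

  CellAt : ℕ → ℕ → Set
  CellAt k f = ∃[ x ] x ∈ els × κ x ≡ k × φ x ≡ f

  -- The position (k , f) need not be a cell, but some element lies weakly below it; by `fill` it is
  -- a cell once `gap k ≤ f`.
  Dominated : ℕ → ℕ → Set
  Dominated k f = ∃[ x ] x ∈ els × k ≤ κ x × f ≤ φ x

  dominates : ∀ {k f} → CellAt k f → Dominated k f
  dominates (x , x∈ , refl , refl) = x , x∈ , ℕₚ.≤-refl , ℕₚ.≤-refl

  cellAt : ∀ {k f} → Dominated k f → gap k ≤ f → CellAt k f
  cellAt (x , x∈ , k≤ , f≤) = fill x∈ k≤ f≤

  rowNum-empty : ∀ k f → f ≤ gap k → rowNum k f ≈ 𝟘
  rowNum-empty k f f≤ = ≈-trans (Π-cong (k +ℕ f) (rowSum-empty k f f≤)) (∏-𝟘 _ (k +ℕ f))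

  rowNum-suc : ∀ {k f} → CellAt k f →
               rowNum k (suc f) ≈ rowNum k f ⊕ mono (H ∸ (k +ℕ f)) (rowsNum k f)
  rowNum-suc (x , x∈ , refl , refl) = begin
    Π (κ x +ℕ suc (φ x)) R⁺          ≡⟨ cong (λ n → Π n R⁺) (ℕₚ.+-suc (κ x) (φ x)) ⟩
    Π (suc n) R⁺                     ≈⟨ Π-at x∈ (factor-rowSum x∈) ⟩
    Π n (R ⊕ mono (rk x) W)          ≈⟨ Π-⊕ n R _ ⟩
    Π n R ⊕ Π n (mono (rk x) W)      ≈⟨ ⊕-cong {S = Π n R} (λ _ _ → refl) (∏-mono (suc H ∸ n) n (rk x) W) ⟩
    Π n R ⊕ mono (rk x) (Π n W)      ≡⟨ cong (λ a → Π n R ⊕ mono a (Π n W)) (rk≡ x∈) ⟩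
    Π n R ⊕ mono (H ∸ n) (Π n W)     ∎
    where
    n = κ x +ℕ φ x
    R⁺ = rowSum (κ x) (suc (φ x))
    R = rowSum (κ x) (φ x)
    W = rowsSum (κ x) (φ x)

  rowsNum-suc : ∀ {k f} → CellAt k f → rowsNum (suc k) f ≈ rowsNum k f ⊕ rowNum k f
  rowsNum-suc (x , x∈ , refl , refl) = ≈-trans (Π-at x∈ (factor-rowsSum x∈))
    (Π-⊕ (κ x +ℕ φ x) (rowsSum (κ x) (φ x)) _)

  -- At the top, `rank` forces κ + φ = 0, and the gap of its row is at most φ.
  gap-zero : gap 0 ≡ 0
  gap-zero = ℕₚ.n≤0⇒n≡0 (ℕₚ.≤-trans (gap-mono z≤n) (ℕₚ.≤-trans (gap≤ top∈) (ℕₚ.≤-trans (ℕₚ.m≤n+m _ (κ top))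
    (ℕₚ.≤-reflexive (ℕₚ.+-cancelˡ-≡ H _ 0 (trans (rank top∈) (sym (ℕₚ.+-identityʳ H))))))))

  -- Row 0 is totally ordered with one cell per rank, so its zeta series is the reciprocal of the
  -- product of its factors. In the induction, the monomial multiple lost by `rowsNum 0` is gained
  -- by `rowNum 0`.
  rowsNum-one : ∀ f → CellAt 0 f → rowsNum 1 f ≈ 𝟙
  rowsNum-one f c = ≈-trans (rowsNum-suc c) (go f (dominates c))
    where
    go : ∀ f → Dominated 0 f → rowsNum 0 f ⊕ rowNum 0 f ≈ 𝟙
    go zero    d m l = trans (cong₂ _+_ (rowsSum-zero 0 m l) (rowNum-empty 0 0 z≤n m l)) (ℤₚ.+-identityʳ _)
    go (suc f) d@(x , x∈ , _ , f<) = ≈-trans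
      (λ m l → trans (cong₂ _+_ (rowsNum-step m l) (rowNum-suc c′ m l)) (cancel (rowsNum 0 f m l) _ _))
      (go f (dominates c′))
      where
      c′ : CellAt 0 f
      c′ = cellAt (x , x∈ , z≤n , ℕₚ.<⇒≤ f<) (subst (_≤ f) (sym gap-zero) z≤n)
      f≤H : f ≤ H
      f≤H = ℕₚ.≤-trans (ℕₚ.<⇒≤ f<) (ℕₚ.≤-trans (ℕₚ.m≤n+m _ (κ x)) (κ+φ≤H x∈))
      rowsNum-step : rowsNum 0 (suc f) ≈ [1-q^ H ∸ f t]· rowsNum 0 f
      rowsNum-step = begin
        Π (suc f) (rowsSum 0 (suc f))          ≡⟨ Π-suc f _ f≤H ⟩
        [1-q^ H ∸ f t]· Π f (rowsSum 0 (suc f)) ≈⟨ factor-cong (H ∸ f) (Π-cong f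
                                                    (≈-trans (rowsSum-zero (suc f)) (≈-sym (rowsSum-zero f)))) ⟩
        [1-q^ H ∸ f t]· Π f (rowsSum 0 f)      ∎
      cancel : ∀ (v z r : ℤ) → v - z + (r + z) ≡ v + r
      cancel = solve-∀

  -- `rowsNum-suc` and `rowNum-suc` are the recurrences defining `paths` and `east`. The index shift
  -- arises because `rowsSum (suc k)` ends with row k.
  rowsNum≈paths : ∀ k f → CellAt k f → rowsNum (suc k) f ≈ paths gap k f
  -- The row sum uses only column distances below f, so domination is required just at `pred f`.
  rowNum≈east : ∀ k f → Dominated (suc k) (pred f) → rowNum (suc k) f ≈ east gap k f
  rowsNum≈paths zero    f c = rowsNum-one f c
  rowsNum≈paths (suc k) f c@(x , x∈ , κ≡ , φ≡) = ≈-trans (rowsNum-suc c)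
    (⊕-cong (rowsNum≈paths k f (fill x∈
                (ℕₚ.≤-trans (ℕₚ.n≤1+n k) (ℕₚ.≤-reflexive (sym κ≡))) (ℕₚ.≤-reflexive (sym φ≡))
                (ℕₚ.≤-trans (gap-mono (ℕₚ.n≤1+n k)) (subst₂ _≤_ (cong gap κ≡) φ≡ (gap≤ x∈)))))
            (rowNum≈east k f (x , x∈ , ℕₚ.≤-reflexive (sym κ≡)
                , ℕₚ.≤-trans ℕₚ.pred[n]≤n (ℕₚ.≤-reflexive (sym φ≡)))))
  rowNum≈east k zero    d = rowNum-empty (suc k) 0 z≤n
  rowNum≈east k (suc f) d@(x , x∈ , k< , f≤) with gap (suc k) ≤? f
  ... | no  g = rowNum-empty (suc k) (suc f) (ℕₚ.≰⇒> g)
  ... | yes g = ≈-trans (rowNum-suc (cellAt d g))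
    (⊕-cong (rowNum≈east k f (x , x∈ , k< , ℕₚ.≤-trans ℕₚ.pred[n]≤n f≤))
            (mono-cong (H ∸ (suc k +ℕ f)) (rowsNum≈paths k f
              (fill x∈ (ℕₚ.<⇒≤ k<) f≤ (ℕₚ.≤-trans (gap-mono (ℕₚ.n≤1+n k)) g)))))

  -- Numerators as path enumerators.

  zeta≈rowsSum : ∀ K Φ → (∀ {y} → y ∈ els → κ y ≤ K × φ y ≤ Φ) → zetaSeries ≈ rowsSum (suc K) Φ
  zeta≈rowsSum K Φ bound = ≈-trans zeta-from (⊕-cong {S = 𝟙} (λ _ _ → refl)
    (≈-sym (∑-all (inRows? (suc K) Φ) (λ y∈ → let a , b = bound y∈ in s≤s a , b))))

  numerator≈Π : numeratorSeries P ≈ Π (suc H) zetaSeries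
  numerator≈Π m l = cong (λ a → ∏[1-q^t] a (suc H) zetaSeries m l) (sym (ℕₚ.n∸n≡0 (suc H)))

  -- The poset lies in the rectangle between x and the top, and rank 0 means κ x + φ x = H, so
  -- `rowsNum (suc (κ x)) (φ x)` carries all H + 1 factors.
  numerator≈paths : ∀ {x} → x ∈ els → (∀ {y} → y ∈ els → x ⊑ y) → rk x ≡ 0 →
                    numeratorSeries P ≈ paths gap (κ x) (φ x)
  numerator≈paths {x} x∈ least rk≡0 = begin
    numeratorSeries P                    ≈⟨ numerator≈Π ⟩
    Π (suc H) zetaSeries                 ≈⟨ Π-cong (suc H) (zeta≈rowsSum (κ x) (φ x)
                                              (λ y∈ → Equivalence.to (⊑⇔ x∈ y∈) (least y∈))) ⟩
    Π (suc H) (rowsSum (suc (κ x)) (φ x)) ≡⟨ cong (λ n → Π (suc n) (rowsSum (suc (κ x)) (φ x)))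
                                              (trans (sym (rank x∈)) (cong (_+ℕ (κ x +ℕ φ x)) rk≡0)) ⟩
    rowsNum (suc (κ x)) (φ x)            ≈⟨ rowsNum≈paths (κ x) (φ x) (x , x∈ , refl , refl) ⟩
    paths gap (κ x) (φ x)                ∎

  -- There need not be a least element, so rows are added one at a time. Each ends at its rank 0
  -- cell (k , H ∸ k), for which `Π (suc H)` is the right normalisation of the full row sum.
  numerator≈totalPaths : ∀ n → (∀ {y} → y ∈ els → κ y ≤ n) → (∀ k → k ≤ n → k ≤ H × CellAt k (H ∸ k)) →
                         numeratorSeries P ≈ totalPaths gap n
  numerator≈totalPaths n bound minimal = begin
    numeratorSeries P             ≈⟨ numerator≈Π ⟩
    Π (suc H) zetaSeries          ≈⟨ Π-cong (suc H) (zeta≈rowsSum n H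
                                       (λ y∈ → bound y∈ , φ≤H y∈)) ⟩
    Π (suc H) (rowsSum (suc n) H) ≈⟨ go n ℕₚ.≤-refl ⟩
    totalPaths gap n              ∎
    where
    φ≤H : ∀ {y} → y ∈ els → φ y ≤ H
    φ≤H {y} y∈ = ℕₚ.≤-trans (ℕₚ.m≤n+m _ (κ y)) (κ+φ≤H y∈)

    φ≤H∸κ : ∀ {y} → y ∈ els → φ y ≤ H ∸ κ y
    φ≤H∸κ {y} y∈ = ℕₚ.m+n≤o⇒m≤o∸n (φ y) (subst (_≤ H) (ℕₚ.+-comm (κ y) (φ y)) (κ+φ≤H y∈))

    wholeRow : ∀ k → rowSum k (suc H) ≈ rowSum k (suc (H ∸ k))
    wholeRow k = ∑-cong (inRow? k (suc H)) (inRow? k (suc (H ∸ k))) λ y∈ → mk⇔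
      (λ { (refl , _) → refl , s≤s (φ≤H∸κ y∈) })
      (λ (a , b) → a , ℕₚ.≤-trans b (s≤s (ℕₚ.m∸n≤m H k)))

    go : ∀ k → k ≤ n → Π (suc H) (rowsSum (suc k) H) ≈ totalPaths gap k
    go zero    k≤n = rowsNum-one H (proj₂ (minimal 0 k≤n))
    go (suc k) k<n = begin
      Π (suc H) (rowsSum (suc (suc k)) H)
        ≈⟨ Π-cong (suc H) (≈-trans (rowsSum-suc (suc k) H)
             (⊕-cong {S = rowsSum (suc k) H} (λ _ _ → refl) (wholeRow (suc k)))) ⟩
      Π (suc H) (rowsSum (suc k) H ⊕ rowSum (suc k) (suc (H ∸ suc k)))
        ≈⟨ Π-⊕ (suc H) (rowsSum (suc k) H) _ ⟩
      Π (suc H) (rowsSum (suc k) H) ⊕ Π (suc H) (rowSum (suc k) (suc (H ∸ suc k)))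
        ≈⟨ ⊕-cong (go k (ℕₚ.<⇒≤ k<n)) lastRow ⟩
      totalPaths gap k ⊕ east gap k (H ∸ k) ∎
      where
      k<H : suc k ≤ H
      k<H = proj₁ (minimal (suc k) k<n)
      suc-∸ : suc (H ∸ suc k) ≡ H ∸ k
      suc-∸ = sym (ℕₚ.+-∸-assoc 1 k<H)
      lastRow : Π (suc H) (rowSum (suc k) (suc (H ∸ suc k))) ≈ east gap k (H ∸ k)
      lastRow = begin
        Π (suc H) (rowSum (suc k) (suc (H ∸ suc k)))
          ≡⟨ cong (λ j → Π j (rowSum (suc k) (suc (H ∸ suc k))))
               (trans (cong suc (sym (ℕₚ.m+[n∸m]≡n k<H))) (sym (ℕₚ.+-suc (suc k) _))) ⟩
        rowNum (suc k) (suc (H ∸ suc k))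
          ≈⟨ rowNum≈east k (suc (H ∸ suc k)) (dominates (proj₂ (minimal (suc k) k<n))) ⟩
        east gap k (suc (H ∸ suc k))
          ≡⟨ cong (east gap k) suc-∸ ⟩
        east gap k (H ∸ k) ∎

-- Coordinates on intervals.

module _ {P : GradedPoset} {gap : ℕ → ℕ} (coords : Coordinates P gap)
         {x y : Carrier P} (x∈ : x ∈ elements P) (y∈ : y ∈ elements P)
         (x⊑y : GradedPoset._⊑_ P x y) where
  open Coordinates coords
  open GradedPoset P using (_⊑_; _⊑?_; ⊑-refl; ⊑-trans)

  I : GradedPoset
  I = interval P x∈ y∈ x⊑y

  between? : Decidable (λ z → x ⊑ z × z ⊑ y)
  between? z = (x ⊑? z) ×-dec (z ⊑? y)

  ∈-interval⁻ : ∀ {z} → z ∈ elements I → z ∈ elements P × x ⊑ z × z ⊑ y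
  ∈-interval⁻ = ∈-filter⁻ between? {xs = elements P}

  ∈-interval⁺ : ∀ {z} → z ∈ elements P → x ⊑ z → z ⊑ y → z ∈ elements I
  ∈-interval⁺ z∈ x⊑z z⊑y = ∈-filter⁺ between? z∈ (x⊑z , z⊑y)

  -- The origin moves to y. A row extending further right than y is cut off at the column of y,
  -- where truncated subtraction gives 0.
  intervalGap : ℕ → ℕ
  intervalGap k = gap (κ y +ℕ k) ∸ φ y

  intervalCoordinates : Coordinates I intervalGap
  intervalCoordinates = record
    { κ        = λ z → κ z ∸ κ y
    ; φ        = λ z → φ z ∸ φ y
    ; ⊑⇔       = λ u∈ v∈ →
        let u∈P , _ , u⊑y = ∈-interval⁻ u∈
            v∈P , _ , v⊑y = ∈-interval⁻ v∈
            κy≤κu , φy≤φu = Equivalence.to (⊑⇔ u∈P y∈) u⊑y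
        in mk⇔
          (λ u⊑v → let a , b = Equivalence.to (⊑⇔ u∈P v∈P) u⊑v in ℕₚ.∸-monoˡ-≤ (κ y) a , ℕₚ.∸-monoˡ-≤ (φ y) b)
          (λ (a , b) → Equivalence.from (⊑⇔ u∈P v∈P) (∸-cancel-≤ κy≤κu a , ∸-cancel-≤ φy≤φu b))
    ; rank     = λ {z} z∈ →
        let z∈P , x⊑z , z⊑y = ∈-interval⁻ z∈
            κy≤κz , φy≤φz = Equivalence.to (⊑⇔ z∈P y∈) z⊑y
        in rank-interval (ρ-mono P x∈ z∈P x⊑z) κy≤κz φy≤φz (trans (rank z∈P) (sym (rank y∈)))
    ; gap≤     = λ {z} z∈ →
        let z∈P , _ , z⊑y = ∈-interval⁻ z∈
            κy≤κz , _ = Equivalence.to (⊑⇔ z∈P y∈) z⊑y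
        in ℕₚ.∸-monoˡ-≤ (φ y) (subst (λ k → gap k ≤ φ z) (sym (ℕₚ.m+[n∸m]≡n κy≤κz)) (gap≤ z∈P))
    ; gap-mono = λ k≤l → ℕₚ.∸-monoˡ-≤ (φ y) (gap-mono (ℕₚ.+-monoʳ-≤ (κ y) k≤l))
    ; fill     = λ {z} {k} {f} z∈ k≤ f≤ g≤ →
        let z∈P , x⊑z , z⊑y = ∈-interval⁻ z∈
            κy≤κz , φy≤φz = Equivalence.to (⊑⇔ z∈P y∈) z⊑y
            κ≤ = ℕₚ.≤-trans (ℕₚ.+-monoʳ-≤ (κ y) k≤) (ℕₚ.≤-reflexive (ℕₚ.m+[n∸m]≡n κy≤κz))
            φ≤ = ℕₚ.≤-trans (ℕₚ.+-monoʳ-≤ (φ y) f≤) (ℕₚ.≤-reflexive (ℕₚ.m+[n∸m]≡n φy≤φz))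
            w , w∈ , κw≡ , φw≡ = fill z∈P κ≤ φ≤ (ℕₚ.≤-trans (ℕₚ.m≤n+m∸n _ (φ y)) (ℕₚ.+-monoʳ-≤ (φ y) g≤))
        in w
         , ∈-interval⁺ w∈
             (⊑-trans x⊑z (Equivalence.from (⊑⇔ z∈P w∈)
               (subst (_≤ κ z) (sym κw≡) κ≤ , subst (_≤ φ z) (sym φw≡) φ≤)))
             (Equivalence.from (⊑⇔ w∈ y∈)
               (subst (κ y ≤_) (sym κw≡) (ℕₚ.m≤m+n (κ y) k) , subst (φ y ≤_) (sym φw≡) (ℕₚ.m≤m+n (φ y) f)))
         , trans (cong (_∸ κ y) κw≡) (ℕₚ.m+n∸m≡n (κ y) k)
         , trans (cong (_∸ φ y) φw≡) (ℕₚ.m+n∸m≡n (φ y) f)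
    }
    where
    ∸-cancel-≤ : ∀ {a b c} → c ≤ b → a ∸ c ≤ b ∸ c → a ≤ b
    ∸-cancel-≤ {a} {b} {c} c≤b h = ℕₚ.≤-trans (ℕₚ.m≤n+m∸n a c)
      (ℕₚ.≤-trans (ℕₚ.+-monoʳ-≤ c h) (ℕₚ.≤-reflexive (ℕₚ.m+[n∸m]≡n c≤b)))

    rank-interval : ∀ {rx rz ry kz ky fz fy} → rx ≤ rz → ky ≤ kz → fy ≤ fz →
                    rz +ℕ (kz +ℕ fz) ≡ ry +ℕ (ky +ℕ fy) →
                    (rz ∸ rx) +ℕ ((kz ∸ ky) +ℕ (fz ∸ fy)) ≡ ry ∸ rx
    rank-interval {rx} {ry = ry} {ky = ky} {fy = fy} p q r e
      -- Writing the larger quantities as sums resolves the differences on the left; then ky + fy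
      -- cancels in `e`.
      with a , refl ← ℕₚ.m≤n⇒∃[o]m+o≡n p | b , refl ← ℕₚ.m≤n⇒∃[o]m+o≡n q | c , refl ← ℕₚ.m≤n⇒∃[o]m+o≡n r
      rewrite ℕₚ.m+n∸m≡n rx a | ℕₚ.m+n∸m≡n ky b | ℕₚ.m+n∸m≡n fy c
      = trans (sym (ℕₚ.m+n∸m≡n rx _))
          (cong (_∸ rx) (ℕₚ.+-cancelʳ-≡ (ky +ℕ fy) _ ry (trans (regroup rx a ky b fy c) e)))
      where
      regroup : ∀ rx a ky b fy c → rx +ℕ (a +ℕ (b +ℕ c)) +ℕ (ky +ℕ fy) ≡ rx +ℕ a +ℕ (ky +ℕ b +ℕ (fy +ℕ c))
      regroup = ℕ-RingSolver.solve-∀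

  numerator-interval : numeratorSeries I ≈ Paths.paths (ρ P y ∸ ρ P x) intervalGap (κ x ∸ κ y) (φ x ∸ φ y)
  numerator-interval = Numerator.numerator≈paths intervalCoordinates
    (∈-interval⁺ x∈ ⊑-refl x⊑y) (λ z∈ → proj₁ (proj₂ (∈-interval⁻ z∈))) (ℕₚ.n∸n≡0 (ρ P x))

-- Coordinates on Ferrers shapes.

module _ {n : ℕ} where

  -- Row indices beyond the last one are read as the last one.
  clamp : ℕ → Fin (suc n)
  clamp k = fromℕ< (s≤s (ℕₚ.m⊓n≤n k n))

  toℕ-clamp : ∀ k → toℕ (clamp k) ≡ k ⊓ n
  toℕ-clamp k = Finₚ.toℕ-fromℕ< _

  toℕ-clamp-≤ : ∀ {k} → k ≤ n → toℕ (clamp k) ≡ k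
  toℕ-clamp-≤ {k} k≤n = trans (toℕ-clamp k) (ℕₚ.m≤n⇒m⊓n≡m k≤n)

  clamp-toℕ : ∀ i → clamp (toℕ i) ≡ i
  clamp-toℕ i = Finₚ.toℕ-injective (toℕ-clamp-≤ (s≤s⁻¹ (Finₚ.toℕ<n i)))

  clamp-mono : ∀ {k l} → k ≤ l → clamp k Fin.≤ clamp l
  clamp-mono {k} {l} k≤l = subst₂ _≤_ (sym (toℕ-clamp k)) (sym (toℕ-clamp l)) (ℕₚ.⊓-monoˡ-≤ n k≤l)

  -- Measured against the first row, so that with equal first entries a larger boundary has smaller
  -- gaps.
  rowGap : Boundary (suc n) → ℕ → ℕ
  rowGap b k = entry b zero ∸ entry b (clamp k)

  F-coordinates : (b : Boundary (suc n)) → Coordinates (F b) (rowGap b)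
  F-coordinates b = record
    { κ        = toℕ ∘ proj₁
    ; φ        = λ (i , c) → b₁ ∸ c
    ; ⊑⇔       = λ {x} {y} x∈ y∈ → mk⇔
        (λ (p , q) → p , ℕₚ.∸-monoʳ-≤ b₁ q)
        (λ (p , q) → p , ℕₚ.∸-cancelʳ-≤ (col≤ x∈) q)
    ; rank     = λ {x} x∈ → rank′ (proj₁ (∈-cells⁻ b x∈)) (col≤ x∈)
    ; gap≤     = λ { {i , c} x∈ →
        ℕₚ.∸-monoʳ-≤ b₁ (subst (λ j → c ≤ entry b j) (sym (clamp-toℕ i)) (proj₂ (∈-cells⁻ b x∈))) }
    ; gap-mono = λ k≤l → ℕₚ.∸-monoʳ-≤ b₁ (nonincreasing b (clamp-mono k≤l))
    ; fill     = λ { {i , c} {k} {f} x∈ k≤i f≤ g≤ →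
        let k≡ = toℕ-clamp-≤ (ℕₚ.≤-trans k≤i (s≤s⁻¹ (Finₚ.toℕ<n i)))
            f≤b₁ = ℕₚ.≤-trans f≤ (ℕₚ.m∸n≤m b₁ c)
            c≤ = ℕₚ.≤-trans (ℕₚ.≤-reflexive (sym (ℕₚ.m∸[m∸n]≡n (col≤ x∈)))) (ℕₚ.∸-monoʳ-≤ b₁ f≤)
        in (clamp k , b₁ ∸ f)
         , ∈-cells⁺ b
             -- The diagonal bound passes from the given cell because the new one has no larger row
             -- and no smaller column; the boundary bound is the gap condition.
             ( subst (λ j → suc j ≤ b₁ ∸ f) (sym k≡) (ℕₚ.≤-trans (s≤s k≤i) (ℕₚ.≤-trans (proj₁ (∈-cells⁻ b x∈)) c≤))
             , ℕₚ.≤-trans (ℕₚ.∸-monoʳ-≤ b₁ g≤) (ℕₚ.≤-reflexive (ℕₚ.m∸[m∸n]≡n (nonincreasing b z≤n))))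
         , k≡
         , ℕₚ.m∸[m∸n]≡n f≤b₁ }
    }
    where
    b₁ = entry b zero
    col≤ : ∀ {x} → x ∈ cells b → proj₂ x ≤ b₁
    col≤ x∈ = ℕₚ.≤-trans (proj₂ (∈-cells⁻ b x∈)) (nonincreasing b z≤n)

    rank′ : ∀ {i c d} → suc i ≤ c → c ≤ d → (c ∸ suc i) +ℕ (i +ℕ (d ∸ c)) ≡ d ∸ 1
    rank′ {i} p q with a , refl ← ℕₚ.m≤n⇒∃[o]m+o≡n p with e , refl ← ℕₚ.m≤n⇒∃[o]m+o≡n q
      rewrite ℕₚ.m+n∸m≡n i a | ℕₚ.m+n∸m≡n (i +ℕ a) e = regroup a i e
      where
      regroup : ∀ a i e → a +ℕ (i +ℕ e) ≡ i +ℕ a +ℕ e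
      regroup = ℕ-RingSolver.solve-∀

  numerator-F : (b : Boundary (suc n)) →
                numeratorSeries (F b) ≈ Paths.totalPaths (entry b zero ∸ 1) (rowGap b) n
  numerator-F b = Numerator.numerator≈totalPaths (F-coordinates b) n
    (λ { {i , _} _ → s≤s⁻¹ (Finₚ.toℕ<n i) })
    (λ k k≤n → let k<b₁ = k<b₁ k≤n in ℕₚ.m+n≤o⇒m≤o∸n k (subst (_≤ b₁) (ℕₚ.+-comm 1 k) k<b₁) , minimal k≤n k<b₁)
    where
    b₁ = entry b zero
    k<b₁ : ∀ {k} → k ≤ n → k < b₁
    k<b₁ {k} k≤n = subst (λ l → suc l ≤ b₁) (toℕ-clamp-≤ k≤n)
      (ℕₚ.≤-trans (diagonal b (clamp k)) (nonincreasing b z≤n))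
    minimal : ∀ {k} → k ≤ n → k < b₁ → Numerator.CellAt (F-coordinates b) k (b₁ ∸ 1 ∸ k)
    minimal {k} k≤n k<b₁ =
        -- The diagonal cell of this row, which has rank 0.
        (clamp k , suc k)
      , ∈-cells⁺ b (ℕₚ.≤-reflexive (cong suc k≡) , subst (λ l → suc l ≤ entry b (clamp k)) k≡ (diagonal b (clamp k)))
      , k≡
      , sym (ℕₚ.∸-+-assoc b₁ 1 k)
      where k≡ = toℕ-clamp-≤ k≤n

-- Comparison of nested boundaries.

≼-from-⊴ : ∀ P Q {S T} → numeratorSeries P ≈ S → numeratorSeries Q ≈ T → S ⊴ T → ℍ P ≼ ℍ Q
≼-from-⊴ P Q p q S⊴T m k = ℤₚ.i≤j⇒0≤j-i (subst₂ _≤ℤ_ (sym (p m k)) (sym (q m k)) (S⊴T m k))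

module _ {n : ℕ} (b b′ : Boundary (suc n)) (same : entry b zero ≡ entry b′ zero)
         (b≤b′ : ∀ i → entry b i ≤ entry b′ i) where

  rowGap-antitone : ∀ k → rowGap b′ k ≤ rowGap b k
  rowGap-antitone k = subst (λ d → d ∸ entry b′ (clamp k) ≤ rowGap b k) same
    (ℕₚ.∸-monoʳ-≤ (entry b zero) (b≤b′ (clamp k)))

  ℍ-F-mono : ℍ (F b) ≼ ℍ (F b′)
  ℍ-F-mono = ≼-from-⊴ (F b) (F b′) (numerator-F b)
    -- Equal first entries give both shapes the same maximal rank, on which the path weights depend.
    (subst (λ d → numeratorSeries (F b′) ≈ Paths.totalPaths (d ∸ 1) (rowGap b′) n) (sym same) (numerator-F b′))
    (Paths.totalPaths-antitone _ rowGap-antitone n)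

  ℍ-interval-mono : ∀ {x y} (x∈ : x ∈ cells b) (y∈ : y ∈ cells b) (x∈′ : x ∈ cells b′) (y∈′ : y ∈ cells b′)
                    (x≤y : x ≤ᶜ y) → ℍ (interval (F b) x∈ y∈ x≤y) ≼ ℍ (interval (F b′) x∈′ y∈′ x≤y)
  ℍ-interval-mono {x} {y} x∈ y∈ x∈′ y∈′ x≤y = ≼-from-⊴ (interval (F b) x∈ y∈ x≤y) (interval (F b′) x∈′ y∈′ x≤y)
    (numerator-interval (F-coordinates b) x∈ y∈ x≤y)
    -- Column distances are taken from the first entry, so `same` is what gives x and y equal
    -- coordinates in both shapes.
    (subst (λ d → numeratorSeries (interval (F b′) x∈′ y∈′ x≤y) ≈
                  Paths.paths _ (λ k → rowGap b′ (toℕ (proj₁ y) +ℕ k) ∸ (d ∸ proj₂ y))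
                    (toℕ (proj₁ x) ∸ toℕ (proj₁ y)) (d ∸ proj₂ x ∸ (d ∸ proj₂ y)))
           (sym same) (numerator-interval (F-coordinates b′) x∈′ y∈′ x≤y))
    (Paths.paths-antitone _ (λ k → ℕₚ.∸-monoˡ-≤ (entry b zero ∸ proj₂ y) (rowGap-antitone (toℕ (proj₁ y) +ℕ k)))
      (toℕ (proj₁ x) ∸ toℕ (proj₁ y)) _)

-- Every entry is at least the last one, which the diagonal condition makes at least r.
lowest≤ : ∀ {n b₁} (r≤b₁ : suc n ≤ b₁) (b : Boundary (suc n)) → entry b zero ≡ b₁ →
          ∀ i → entry (lowest b₁ r≤b₁) i ≤ entry b i
lowest≤ r≤b₁ b refl zero = ℕₚ.≤-refl
lowest≤ {n} r≤b₁ b refl (suc i) = ℕₚ.≤-trans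
  (subst (λ l → suc l ≤ entry b (Fin.fromℕ n)) (Finₚ.toℕ-fromℕ n) (diagonal b (Fin.fromℕ n)))
  (nonincreasing b (Finₚ.≤fromℕ (suc i)))

corollary5p14 : (n b₁ : ℕ) →
    ((b b′ : Boundary (suc n)) →
    entry b zero ≡ b₁ → entry b′ zero ≡ b₁ → (∀ i → entry b i ≤ entry b′ i) →
    (ℍ (F b) ≼ ℍ (F b′))
    × (∀ {x y} (x∈ : x ∈ cells b) (y∈ : y ∈ cells b)
    (x∈′ : x ∈ cells b′) (y∈′ : y ∈ cells b′) (x≤y : x ≤ᶜ y) →
    ℍ (interval (F b) x∈ y∈ x≤y) ≼ ℍ (interval (F b′) x∈′ y∈′ x≤y)))
    × ((r≤b₁ : suc n ≤ b₁) (b : Boundary (suc n)) → entry b zero ≡ b₁ →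
    (ℍ (F (lowest b₁ r≤b₁)) ≼ ℍ (F b)) × (ℍ (F b) ≼ ℍ (F (highest b₁ r≤b₁))))
corollary5p14 n b₁ =
    (λ b b′ e e′ b≤b′ → let same = trans e (sym e′) in ℍ-F-mono b b′ same b≤b′ , ℍ-interval-mono b b′ same b≤b′)
  , (λ r≤b₁ b e →
        ℍ-F-mono (lowest b₁ r≤b₁) b (sym e) (lowest≤ r≤b₁ b e)
      , ℍ-F-mono b (highest b₁ r≤b₁) e (λ i → subst (entry b i ≤_) e (nonincreasing b z≤n)))
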